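{- For every integer $r \ge 2$ there exists $N = N(r)$ such that for all integers $n \ge N$, \[ \hat{R}(P_n, r) < 600 (\log r)\, r^2 n . \]
   Context: $P_n$ denotes the path on $n$ vertices. For a graph $F$ and an integer $r\ge 1$, write $G \to (F)_r$ if every colouring of the edges of $G$ with $r$ colours yields a monochromatic copy of $F$ (i.e. a subgraph isomorphic to $F$ all of whose edges have the same colour). The size-Ramsey number $\hat{R}(F,r)$ is the minimum number of edges $|E(G)|$ over all graphs $G$ with $G \to (F)_r$. $\log$ denotes the natural logarithm. -}

module Defs where

open import Data.Nat.Base as ℕ using (ℕ; zero; suc; z≤n; s≤s)
import Data.Nat.Properties as ℕ
open import Data.Integer.Base as ℤ using (+_; +[1+_]; +≤+)
import Data.Integer.Properties as ℤ
open import Data.Rational.Unnormalised.Base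
open import Data.Rational.Unnormalised.Properties
open import Data.Rational.Unnormalised.Solver using (module +-*-Solver)
open import Data.Fin.Base as Fin using (Fin; toℕ)
import Data.Fin.Properties as Fin
open import Data.List.Base using (length; filter; cartesianProduct; allFin)
open import Data.Product.Base using (_×_; _,_; ∃-syntax; Σ-syntax)
open import Data.Sum.Base using (_⊎_; inj₁; inj₂; swap)
open import Function.Definitions using (Injective)
open import Level using (0ℓ)
open import Relation.Binary.Core using (Rel)
open import Relation.Binary.Definitions using (Decidable; Symmetric; Irreflexive)
open import Relation.Nullary.Decidable using (_×-dec_; _⊎-dec_)
open import Relation.Binary.PropositionalEquality
  using (_≡_; refl; cong; subst; module ≡-Reasoning)
  renaming (sym to ≡-sym; trans to ≡-trans)

------------------------------------------------------------------------
-- Graphs, colourings and size-Ramsey numbers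

record Graph : Set₁ where
  field
    order  : ℕ
    _~_    : Rel (Fin order) 0ℓ
    _~?_   : Decidable _~_
    ~-sym  : Symmetric _~_
    ~-irr  : Irreflexive _≡_ _~_

-- Each edge is counted once, as the pair (u , v) with u < v.
size : Graph → ℕ
size G = length (filter (λ (u , v) → (u Fin.<? v) ×-dec (u ~? v))
                        (cartesianProduct (allFin order) (allFin order)))
  where open Graph G

-- The law makes the colour depend only on the unordered pair {u , v}: it
-- covers both orientations and, applied twice, different proofs of u ~ v.
record Colouring (G : Graph) (r : ℕ) : Set where
  open Graph G
  field
    colour     : ∀ {u v} → u ~ v → Fin r
    colour-sym : ∀ {u v} (e : u ~ v) (e′ : v ~ u) → colour e ≡ colour e′

-- Copies are subgraphs, not necessarily induced.
MonochromaticCopy : ∀ {G r} → Graph → Colouring G r → Set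
MonochromaticCopy {G} {r} F χ =
  Σ[ c ∈ Fin r ] Σ[ φ ∈ (Fin F.order → Fin G.order) ]
    Injective _≡_ _≡_ φ ×
    (∀ {u v} → u F.~ v → Σ[ e ∈ φ u G.~ φ v ] colour e ≡ c)
  where
  module F = Graph F
  module G = Graph G
  open Colouring χ

Arrows : Graph → Graph → ℕ → Set
Arrows G F r = (χ : Colouring G r) → MonochromaticCopy F χ

-- IsSizeRamsey F r m expresses R̂(F , r) = m.
record IsSizeRamsey (F : Graph) (r m : ℕ) : Set₁ where
  field
    attained : Σ[ G ∈ Graph ] (Arrows G F r × size G ≡ m)
    minimal  : ∀ G → Arrows G F r → m ℕ.≤ size G

Path : ℕ → Graph
Path n = record
  { order = n
  ; _~_   = λ u v → (toℕ v ≡ suc (toℕ u)) ⊎ (toℕ u ≡ suc (toℕ v))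
  ; _~?_  = λ u v → (toℕ v ℕ.≟ suc (toℕ u)) ⊎-dec (toℕ u ℕ.≟ suc (toℕ v))
  ; ~-sym = swap
  ; ~-irr = λ { refl (inj₁ p) → ℕ.1+n≢n (≡-sym p)
              ; refl (inj₂ p) → ℕ.1+n≢n (≡-sym p) }
  }

------------------------------------------------------------------------
-- Real numbers, as Cauchy sequences of rationals

IsCauchy : (ℕ → ℚᵘ) → Set
IsCauchy x = ∀ ε → 0ℚᵘ < ε →
  ∃[ N ] ∀ m n → N ℕ.≤ m → N ℕ.≤ n → ∣ x m - x n ∣ ≤ ε

record ℝ : Set where
  field
    approx : ℕ → ℚᵘ
    cauchy : IsCauchy approx
open ℝ public

infix 4 _<ℝ_

_<ℝ_ : ℝ → ℝ → Set
x <ℝ y = ∃[ ε ] 0ℚᵘ < ε × ∃[ N ] ∀ k → N ℕ.≤ k → approx x k + ε ≤ approx y k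

fromℕ : ℕ → ℝ
fromℕ n = record
  { approx = λ _ → + n / 1
  ; cauchy = λ ε 0<ε → 0 , λ _ _ _ _ →
      ≤-trans (≤-reflexive (∣-∣-cong (+-inverseʳ (+ n / 1)))) (<⇒≤ 0<ε)
  }

private
  eventually-bounded : ∀ {x} → IsCauchy x →
    ∃[ B ] Positive B × ∃[ N ] ∀ n → N ℕ.≤ n → ∣ x n ∣ ≤ B
  eventually-bounded {x} cx with cx 1ℚᵘ (positive⁻¹ 1ℚᵘ)
  ... | N , close = 1ℚᵘ + ∣ x N ∣ , positive 0<B , N , bound
    where
    open ≤-Reasoning
    0<B : 0ℚᵘ < 1ℚᵘ + ∣ x N ∣
    0<B = <-≤-trans (positive⁻¹ 1ℚᵘ)
            (≤-respˡ-≃ (+-identityʳ 1ℚᵘ) (+-monoʳ-≤ 1ℚᵘ (0≤∣p∣ (x N))))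
    split : ∀ p q → p ≃ (p - q) + q
    split = let open +-*-Solver in
      solve 2 (λ p q → p := (p :- q) :+ q) ≃-refl
    bound : ∀ n → N ℕ.≤ n → ∣ x n ∣ ≤ 1ℚᵘ + ∣ x N ∣
    bound n N≤n = begin
      ∣ x n ∣                   ≃⟨ ∣-∣-cong (split (x n) (x N)) ⟩
      ∣ (x n - x N) + x N ∣     ≤⟨ ∣p+q∣≤∣p∣+∣q∣ (x n - x N) (x N) ⟩
      ∣ x n - x N ∣ + ∣ x N ∣   ≤⟨ +-monoˡ-≤ ∣ x N ∣ (close n N N≤n ℕ.≤-refl) ⟩
      1ℚᵘ + ∣ x N ∣             ∎

  -- δ = ε / 2B
  shrink : ∀ B → Positive B → ∀ ε → 0ℚᵘ < ε → ∃[ δ ] 0ℚᵘ < δ × B * δ ≃ ½ * ε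
  shrink B B>0 ε ε>0 = 1/ B * (½ * ε) , 0<δ , B*δ
    where
    instance
      posB : Positive B
      posB = B>0
      nzB : NonZero B
      nzB = pos⇒nonZero B
      posε : Positive ε
      posε = positive ε>0
      pos1/B : Positive (1/ B)
      pos1/B = 1/pos⇒pos B
      posh : Positive (½ * ε)
      posh = pos*pos⇒pos ½ ε
    0<δ : 0ℚᵘ < 1/ B * (½ * ε)
    0<δ = positive⁻¹ _ {{pos*pos⇒pos (1/ B) (½ * ε)}}
    open ≃-Reasoning
    B*δ : B * (1/ B * (½ * ε)) ≃ ½ * ε
    B*δ = begin
      B * (1/ B * (½ * ε)) ≈⟨ ≃-sym (*-assoc B (1/ B) (½ * ε)) ⟩
      B * 1/ B * (½ * ε)   ≈⟨ *-congʳ (*-inverseʳ B) ⟩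
      1ℚᵘ * (½ * ε)        ≈⟨ *-identityˡ (½ * ε) ⟩
      ½ * ε                ∎

  halves : ∀ ε → ½ * ε + ½ * ε ≃ ε
  halves ε = ≃-trans (≃-sym (*-distribʳ-+ ε ½ ½))
    (≃-trans (*-congʳ {ε} {½ + ½} {1ℚᵘ} (*≡* refl)) (*-identityˡ ε))

  *-cauchy : ∀ {x y} → IsCauchy x → IsCauchy y → IsCauchy (λ n → x n * y n)
  *-cauchy {x} {y} cx cy ε ε>0
    with eventually-bounded {x} cx | eventually-bounded {y} cy
  ... | A , A>0 , Na , ∣x∣≤A | B , B>0 , Nb , ∣y∣≤B
    with shrink B B>0 ε ε>0 | shrink A A>0 ε ε>0
  ... | δ , δ>0 , Bδ | η , η>0 , Aη
    with cx δ δ>0 | cy η η>0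
  ... | Nx , dx | Ny , dy = Na ℕ.+ (Nb ℕ.+ (Nx ℕ.+ Ny)) , close
    where
    open ≤-Reasoning
    expand : ∀ a b c d → a * b - c * d ≃ a * (b - d) + d * (a - c)
    expand = let open +-*-Solver in
      solve 4 (λ a b c d → a :* b :- c :* d := a :* (b :- d) :+ d :* (a :- c)) ≃-refl
    *-mono : ∀ p {q} r {s} → p ≤ q → r ≤ s → 0ℚᵘ ≤ p → 0ℚᵘ ≤ r → p * r ≤ q * s
    *-mono p r p≤q r≤s 0≤p 0≤r =
      *-mono-≤-nonNeg {{nonNegative 0≤p}} {{nonNegative 0≤r}} p≤q r≤s
    close : ∀ m n → Na ℕ.+ (Nb ℕ.+ (Nx ℕ.+ Ny)) ℕ.≤ m →
            Na ℕ.+ (Nb ℕ.+ (Nx ℕ.+ Ny)) ℕ.≤ n → ∣ x m * y m - x n * y n ∣ ≤ ε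
    close m n N≤m N≤n = begin
      ∣ x m * y m - x n * y n ∣
        ≃⟨ ∣-∣-cong (expand (x m) (y m) (x n) (y n)) ⟩
      ∣ x m * (y m - y n) + y n * (x m - x n) ∣
        ≤⟨ ∣p+q∣≤∣p∣+∣q∣ (x m * (y m - y n)) (y n * (x m - x n)) ⟩
      ∣ x m * (y m - y n) ∣ + ∣ y n * (x m - x n) ∣
        ≃⟨ +-cong (∣p*q∣≃∣p∣*∣q∣ (x m) (y m - y n)) (∣p*q∣≃∣p∣*∣q∣ (y n) (x m - x n)) ⟩
      ∣ x m ∣ * ∣ y m - y n ∣ + ∣ y n ∣ * ∣ x m - x n ∣
        ≤⟨ +-mono-≤
             (*-mono ∣ x m ∣ ∣ y m - y n ∣ (∣x∣≤A m (toA N≤m)) (dy m n (toY N≤m) (toY N≤n))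
                     (0≤∣p∣ (x m)) (0≤∣p∣ (y m - y n)))
             (*-mono ∣ y n ∣ ∣ x m - x n ∣ (∣y∣≤B n (toB N≤n)) (dx m n (toX N≤m) (toX N≤n))
                     (0≤∣p∣ (y n)) (0≤∣p∣ (x m - x n))) ⟩
      A * η + B * δ       ≃⟨ +-cong Aη Bδ ⟩
      ½ * ε + ½ * ε       ≃⟨ halves ε ⟩
      ε                   ∎
      where
      toA : ∀ {k} → Na ℕ.+ (Nb ℕ.+ (Nx ℕ.+ Ny)) ℕ.≤ k → Na ℕ.≤ k
      toA = ℕ.m+n≤o⇒m≤o Na
      toB : ∀ {k} → Na ℕ.+ (Nb ℕ.+ (Nx ℕ.+ Ny)) ℕ.≤ k → Nb ℕ.≤ k
      toB p = ℕ.m+n≤o⇒m≤o Nb (ℕ.m+n≤o⇒n≤o Na p)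
      toX : ∀ {k} → Na ℕ.+ (Nb ℕ.+ (Nx ℕ.+ Ny)) ℕ.≤ k → Nx ℕ.≤ k
      toX p = ℕ.m+n≤o⇒m≤o Nx (ℕ.m+n≤o⇒n≤o Nb (ℕ.m+n≤o⇒n≤o Na p))
      toY : ∀ {k} → Na ℕ.+ (Nb ℕ.+ (Nx ℕ.+ Ny)) ℕ.≤ k → Ny ℕ.≤ k
      toY p = ℕ.m+n≤o⇒n≤o Nx (ℕ.m+n≤o⇒n≤o Nb (ℕ.m+n≤o⇒n≤o Na p))

infixl 7 _*ℝ_

_*ℝ_ : ℝ → ℝ → ℝ
x *ℝ y = record
  { approx = λ n → approx x n * approx y n
  ; cauchy = *-cauchy {approx x} {approx y} (cauchy x) (cauchy y)
  }

------------------------------------------------------------------------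
-- The natural logarithm of a positive integer

sum : (ℕ → ℚᵘ) → ℕ → ℚᵘ
sum f zero    = 0ℚᵘ
sum f (suc n) = sum f n + f n

-- log r = ∫₁ʳ dt/t. The K-th term is the lower Darboux sum for the partition
-- of [1 , r] into (r - 1) K intervals of length 1/K: since 1/t decreases, it is
--   Σ_{1 ≤ i ≤ (r-1)K} (1/K) · 1/(1 + i/K)  =  Σ_{1 ≤ i ≤ (r-1)K} 1/(K + i).
logSum : ℕ → ℕ → ℚᵘ
logSum r K = sum (λ i → + 1 / suc (K ℕ.+ i)) ((r ℕ.∸ 1) ℕ.* K)

private
  sum-mono : ∀ {f g} n → (∀ i → i ℕ.< n → f i ≤ g i) → sum f n ≤ sum g n
  sum-mono zero    _   = ≤-refl
  sum-mono (suc n) f≤g =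
    +-mono-≤ (sum-mono n (λ i i<n → f≤g i (ℕ.m<n⇒m<1+n i<n))) (f≤g n ℕ.≤-refl)

  sum-+ : ∀ f m n → sum f (m ℕ.+ n) ≃ sum f m + sum (λ j → f (m ℕ.+ j)) n
  sum-+ f m zero rewrite ℕ.+-identityʳ m = ≃-sym (+-identityʳ (sum f m))
  sum-+ f m (suc n) rewrite ℕ.+-suc m n = ≃-trans
    (+-congˡ (f (m ℕ.+ n)) (sum-+ f m n))
    (+-assoc (sum f m) (sum (λ j → f (m ℕ.+ j)) n) (f (m ℕ.+ n)))

  sum-blocks : ∀ f L n →
    sum f (n ℕ.* L) ≃ sum (λ i → sum (λ j → f (i ℕ.* L ℕ.+ j)) L) n
  sum-blocks f L zero = ≃-refl
  sum-blocks f L (suc n) rewrite ℕ.+-comm L (n ℕ.* L) = ≃-trans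
    (sum-+ f (n ℕ.* L) L)
    (+-congˡ (sum (λ j → f (n ℕ.* L ℕ.+ j)) L) (sum-blocks f L n))

  sum-const : ∀ c n → sum (λ _ → c) n ≃ (+ n / 1) * c
  sum-const c zero    = ≃-sym (*-zeroˡ c)
  sum-const c (suc n) = begin
    sum (λ _ → c) n + c         ≈⟨ +-congˡ c (sum-const c n) ⟩
    (+ n / 1) * c + c           ≈⟨ lem (+ n / 1) c ⟩
    (+ n / 1 + 1ℚᵘ) * c         ≈⟨ *-congʳ {c} suc/1 ⟩
    (+ suc n / 1) * c           ∎
    where
    open ≃-Reasoning
    lem : ∀ p q → p * q + q ≃ (p + 1ℚᵘ) * q
    lem = let open +-*-Solver in
      solve 2 (λ p q → p :* q :+ q := (p :+ con 1ℚᵘ) :* q) ≃-refl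
    suc/1 : + n / 1 + 1ℚᵘ ≃ + suc n / 1
    suc/1 = *≡* (cong (ℤ._* + 1)
      (≡-trans (cong (ℤ._+ + 1) (ℤ.*-identityʳ (+ n))) (cong +_ (ℕ.+-comm n 1))))

  1/-anti : ∀ m n .{{_ : ℕ.NonZero m}} .{{_ : ℕ.NonZero n}} →
            m ℕ.≤ n → + 1 / n ≤ + 1 / m
  1/-anti (suc m) (suc n) m≤n = *≤* (+≤+ (ℕ.+-monoˡ-≤ 0 m≤n))

  0≤1/ : ∀ n → 0ℚᵘ ≤ + 1 / suc n
  0≤1/ n = nonNegative⁻¹ (+ 1 / suc n)

  average : ∀ a l → sum (λ _ → + 1 / (suc a ℕ.* suc l)) (suc l) ≃ + 1 / suc a
  average a l = ≃-trans (sum-const (+ 1 / (suc a ℕ.* suc l)) (suc l)) (*≡* eq)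
    where
    open ≡-Reasoning
    eq : + suc l ℤ.* + 1 ℤ.* + suc a ≡ + 1 ℤ.* + (1 ℕ.* (suc a ℕ.* suc l))
    eq = begin
      + suc l ℤ.* + 1 ℤ.* + suc a    ≡⟨ cong (ℤ._* + suc a) (ℤ.*-identityʳ (+ suc l)) ⟩
      + suc l ℤ.* + suc a            ≡⟨ ℤ.*-comm (+ suc l) (+ suc a) ⟩
      + suc a ℤ.* + suc l            ≡⟨ ≡-sym (ℤ.pos-* (suc a) (suc l)) ⟩
      + (suc a ℕ.* suc l)            ≡⟨ cong +_ (≡-sym (ℕ.*-identityˡ (suc a ℕ.* suc l))) ⟩
      + (1 ℕ.* (suc a ℕ.* suc l))    ≡⟨ ≡-sym (ℤ.*-identityˡ (+ (1 ℕ.* (suc a ℕ.* suc l)))) ⟩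
      + 1 ℤ.* + (1 ℕ.* (suc a ℕ.* suc l)) ∎

  module Refine (k l : ℕ) where
    K L : ℕ
    K = suc k
    L = suc l

    fine : ℕ → ℚᵘ
    fine i = + 1 / suc (K ℕ.* L ℕ.+ i)

    regroup : ∀ i j → K ℕ.* L ℕ.+ (i ℕ.* L ℕ.+ j) ≡ (K ℕ.+ i) ℕ.* L ℕ.+ j
    regroup i j = ≡-trans (≡-sym (ℕ.+-assoc (K ℕ.* L) (i ℕ.* L) j))
                          (cong (ℕ._+ j) (≡-sym (ℕ.*-distribʳ-+ L K i)))

    block-lower : ∀ i → + 1 / suc (K ℕ.+ i) ≤ sum (λ j → fine (i ℕ.* L ℕ.+ j)) L
    block-lower i = ≤-respˡ-≃ (average (K ℕ.+ i) l) (sum-mono L λ j j<L →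
      1/-anti (suc (K ℕ.* L ℕ.+ (i ℕ.* L ℕ.+ j))) (suc (K ℕ.+ i) ℕ.* L)
        (subst (ℕ._≤ suc (K ℕ.+ i) ℕ.* L) (cong suc (≡-sym (regroup i j)))
          (subst ((K ℕ.+ i) ℕ.* L ℕ.+ j ℕ.<_) (ℕ.+-comm ((K ℕ.+ i) ℕ.* L) L)
            (ℕ.+-monoʳ-< ((K ℕ.+ i) ℕ.* L) j<L))))

    block-upper : ∀ i → sum (λ j → fine (i ℕ.* L ℕ.+ j)) L ≤ + 1 / (K ℕ.+ i)
    block-upper i = ≤-respʳ-≃ (average (k ℕ.+ i) l) (sum-mono L λ j _ →
      1/-anti ((K ℕ.+ i) ℕ.* L) (suc (K ℕ.* L ℕ.+ (i ℕ.* L ℕ.+ j)))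
        (subst ((K ℕ.+ i) ℕ.* L ℕ.≤_) (cong suc (≡-sym (regroup i j)))
          (ℕ.m≤n⇒m≤1+n (ℕ.m≤m+n ((K ℕ.+ i) ℕ.* L) j))))

    shift : ∀ n → sum (λ i → + 1 / (K ℕ.+ i)) n + + 1 / (K ℕ.+ n)
                ≃ + 1 / K + sum (λ i → + 1 / suc (K ℕ.+ i)) n
    shift zero rewrite ℕ.+-identityʳ k = +-comm 0ℚᵘ (+ 1 / suc k)
    shift (suc n) rewrite ℕ.+-suc k n = ≃-trans
      (+-congˡ (+ 1 / suc (suc (k ℕ.+ n))) (shift n))
      (+-assoc (+ 1 / K) (sum (λ i → + 1 / suc (K ℕ.+ i)) n) (+ 1 / suc (suc (k ℕ.+ n))))

    lower : ∀ n → sum (λ i → + 1 / suc (K ℕ.+ i)) n ≤ sum fine (n ℕ.* L)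
    lower n = ≤-respʳ-≃ (≃-sym (sum-blocks fine L n)) (sum-mono n λ i _ → block-lower i)

    upper : ∀ n → sum fine (n ℕ.* L) ≤ + 1 / K + sum (λ i → + 1 / suc (K ℕ.+ i)) n
    upper n = begin
      sum fine (n ℕ.* L)                                   ≃⟨ sum-blocks fine L n ⟩
      sum (λ i → sum (λ j → fine (i ℕ.* L ℕ.+ j)) L) n     ≤⟨ sum-mono n (λ i _ → block-upper i) ⟩
      sum (λ i → + 1 / (K ℕ.+ i)) n                        ≃⟨ ≃-sym (+-identityʳ _) ⟩
      sum (λ i → + 1 / (K ℕ.+ i)) n + 0ℚᵘ                  ≤⟨ +-monoʳ-≤ (sum (λ i → + 1 / (K ℕ.+ i)) n) (0≤1/ (k ℕ.+ n)) ⟩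
      sum (λ i → + 1 / (K ℕ.+ i)) n + + 1 / (K ℕ.+ n)      ≃⟨ shift n ⟩
      + 1 / K + sum (λ i → + 1 / suc (K ℕ.+ i)) n          ∎
      where open ≤-Reasoning

  logSum-lower : ∀ r k l → logSum r (suc k) ≤ logSum r (suc k ℕ.* suc l)
  logSum-lower r k l rewrite ≡-sym (ℕ.*-assoc (r ℕ.∸ 1) (suc k) (suc l)) =
    Refine.lower k l ((r ℕ.∸ 1) ℕ.* suc k)

  logSum-upper : ∀ r k l → logSum r (suc k ℕ.* suc l) ≤ + 1 / suc k + logSum r (suc k)
  logSum-upper r k l rewrite ≡-sym (ℕ.*-assoc (r ℕ.∸ 1) (suc k) (suc l)) =
    Refine.upper k l ((r ℕ.∸ 1) ℕ.* suc k)

  logSum-step : ∀ r k l → logSum r (suc k) - logSum r (suc l) ≤ + 1 / suc l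
  logSum-step r k l = begin
    logSum r (suc k) - logSum r (suc l)
      ≤⟨ +-monoˡ-≤ (- logSum r (suc l)) (logSum-lower r k l) ⟩
    logSum r (suc k ℕ.* suc l) - logSum r (suc l)
      ≡⟨ cong (λ n → logSum r n - logSum r (suc l)) (ℕ.*-comm (suc k) (suc l)) ⟩
    logSum r (suc l ℕ.* suc k) - logSum r (suc l)
      ≤⟨ +-monoˡ-≤ (- logSum r (suc l)) (logSum-upper r l k) ⟩
    (+ 1 / suc l + logSum r (suc l)) - logSum r (suc l)
      ≃⟨ cancel (+ 1 / suc l) (logSum r (suc l)) ⟩
    + 1 / suc l ∎
    where
    open ≤-Reasoning
    cancel : ∀ p q → (p + q) - q ≃ p
    cancel = let open +-*-Solver in
      solve 2 (λ p q → (p :+ q) :- q := p) ≃-refl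

  ∣∣-≤ : ∀ p q ε → p - q ≤ ε → q - p ≤ ε → ∣ p - q ∣ ≤ ε
  ∣∣-≤ p q ε p-q≤ε q-p≤ε with ∣p∣≡p∨∣p∣≡-p (p - q)
  ... | inj₁ eq = ≤-respˡ-≃ (≃-reflexive (≡-sym eq)) p-q≤ε
  ... | inj₂ eq = ≤-respˡ-≃ (≃-trans (flip p q) (≃-reflexive (≡-sym eq))) q-p≤ε
    where
    flip : ∀ p q → q - p ≃ - (p - q)
    flip = let open +-*-Solver in
      solve 2 (λ p q → q :- p := :- (p :- q)) ≃-refl

  archimedean : ∀ ε → 0ℚᵘ < ε → ∃[ N ] + 1 / suc N ≤ ε
  archimedean (mkℚᵘ (+ zero) d) (*<* (ℤ.+<+ ()))
  archimedean (mkℚᵘ +[1+ n ] d) _ = d , *≤* (+≤+ (ℕ.+-monoʳ-≤ (suc d) z≤n))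

  logSum-cauchy : ∀ r → IsCauchy (λ k → logSum r (suc k))
  logSum-cauchy r ε ε>0 with archimedean ε ε>0
  ... | N , 1/N≤ε = N , λ m n N≤m N≤n →
    ∣∣-≤ (logSum r (suc m)) (logSum r (suc n)) ε
      (≤-trans (logSum-step r m n) (≤-trans (1/-anti (suc N) (suc n) (s≤s N≤n)) 1/N≤ε))
      (≤-trans (logSum-step r n m) (≤-trans (1/-anti (suc N) (suc m) (s≤s N≤m)) 1/N≤ε))

-- Meaningful for r ≥ 1; the value log 0 = 0 is a dummy.
log : ℕ → ℝ
log r = record
  { approx = λ k → logSum r (suc k)
  ; cauchy = logSum-cauchy r
  }

{-# OPTIONS --safe #-}

-- Let 2^L ≤ r < 2^(L+1) and f = 18Ln. The host graph has N = 16rn vertices and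
-- M = 16r²f = 288Lr²n edges, such that every set of at most 2n vertices contains
-- fewer than f of them.
--
-- Suppose that a colour class has no path on n vertices, and run a depth-first
-- search in it. Whenever n further vertices are finished, emit the bag of these
-- vertices together with the stack, which has fewer than n vertices. No edge of the
-- class joins a finished vertex to an unvisited one, so each edge lies in one of the
-- N/n = 16r bags. If this happens for all r colours, then M ≤ r·16r·(f-1) < M.
--
-- The edges are chosen one at a time so as to keep the potential Σ_X 5^(edges in X),
-- over the sets X of at most 2n vertices, at most its average. A pair of vertices
-- lies in X with probability at most (2n/N)² = 1/(64r²), so each choice multiplies the
-- potential by at most 1 + 4/(64r²) = 1 + 1/(16r²). There are at most (24r)^(2n) sets
-- X, so the final potential is at most (24r)^(2n)·3^f, which is less than 5^f.
--
-- Finally log r ≥ L/2, hence M < 300Lr²n ≤ 600 (log r) r²n.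

module Submission where

open import Defs
open import Data.Nat.Base
open import Data.Nat.Properties hiding (_≟_)
open import Data.Nat.ListAction using () renaming (sum to ∑ᴸ)
open import Data.Nat.Tactic.RingSolver using (solve-∀)
open import Data.Integer.Base as ℤ using (+≤+) renaming (+_ to int)
import Data.Integer.Properties as ℤ
import Data.Integer.Tactic.RingSolver as ℤ-Solver
open import Data.Rational.Unnormalised.Base as ℚ using (ℚᵘ; 0ℚᵘ; 1ℚᵘ; ½; *≤*; *≡*)
import Data.Rational.Unnormalised.Properties as ℚ
open import Data.Bool.Base using (true; false; if_then_else_)
open import Data.Fin.Base as Fin using (Fin; zero; suc; toℕ; inject₁)
import Data.Fin.Properties as Fin
open import Data.List.Base
  using (List; []; _∷_; _++_; length; lookup; map; filter; allFin; cartesianProduct; concatMap)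
open import Data.List.Extrema.Nat using (argmin; f[argmin]≤f[xs])
open import Data.List.Properties using (length-++; length-map; length-tabulate)
open import Data.List.Membership.Propositional using (_∈_; find; lose)
open import Data.List.Membership.Propositional.Properties
open import Data.List.Relation.Binary.Permutation.Propositional using (_↭_; ↭-sym; ↭-trans; ↭⇒↭ₛ)
open import Data.List.Relation.Binary.Permutation.Propositional.Properties
  using (shift; ∈-resp-↭; ↭-length; ++⁺ˡ)
import Data.List.Relation.Binary.Permutation.Setoid.Properties as Permutationₛ
open import Data.List.Relation.Unary.All as All using (All; []; _∷_)
open import Data.List.Relation.Unary.All.Properties using (¬Any⇒All¬; ++⁻ˡ)
open import Data.List.Relation.Unary.AllPairs using ([]; _∷_)
open import Data.List.Relation.Unary.Any using (Any; any?; here; there; index)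
open import Data.List.Relation.Unary.Any.Properties using (concatMap⁺; concatMap⁻; lookup-index)
open import Data.List.Relation.Unary.Linked using (Linked; []; [-]; _∷_; tail)
open import Data.List.Relation.Unary.Unique.Propositional using (Unique)
open import Data.List.Relation.Unary.Unique.Propositional.Properties
  using (filter⁺; cartesianProduct⁺; allFin⁺)
open import Data.Product.Base as Product using (Σ-syntax; ∃; ∃-syntax; _×_; _,_; proj₁; proj₂)
import Data.Product.Properties as Product
open import Data.Sum.Base using (_⊎_; inj₁; inj₂; map₂; swap)
open import Data.Unit.Base using (tt)
open import Data.Vec.Base as Vec using (Vec; []; _∷_)
import Data.Vec.Properties as Vec
open import Algebra.Properties.CommutativeSemigroup *-commutativeSemigroup
  using (x∙yz≈y∙xz; xy∙z≈y∙xz; xy∙z≈xz∙y; xy∙z≈y∙zx)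
open import Function.Base using (_∘_; id; case_of_)
open import Function.Definitions using (Injective)
open import Level using (0ℓ)
open import Relation.Binary.Core using (Rel; REL)
open import Relation.Binary.Definitions using (Decidable; Symmetric; tri<; tri≈; tri>)
open import Relation.Binary.PropositionalEquality
open import Relation.Nullary.Decidable
  using (Dec; yes; no; does; _×-dec_; _⊎-dec_; _→-dec_; ¬?; map′; decidable-stable; dec-true; dec-false)
open import Relation.Nullary.Negation using (¬_; contradiction)
import Relation.Unary as U

private
  variable
    A B : Set

-- Duplicate-free lists

Unique-resp-↭ : {xs ys : List A} → xs ↭ ys → Unique xs → Unique ys
Unique-resp-↭ = Permutationₛ.Unique-resp-↭ (setoid _) ∘ ↭⇒↭ₛ

Unique-++⁻ˡ : (xs : List A) {ys : List A} → Unique (xs ++ ys) → Unique xs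
Unique-++⁻ˡ []       _            = []
Unique-++⁻ˡ (x ∷ xs) (x∉ ∷ xsys!) = ++⁻ˡ xs x∉ ∷ Unique-++⁻ˡ xs xsys!

∈⇒↭ : {x : A} {xs : List A} → x ∈ xs → ∃[ ys ] xs ↭ x ∷ ys
∈⇒↭ {x = x} x∈xs with ys , zs , refl ← ∈-∃++ x∈xs = ys ++ zs , shift x ys zs

Unique∧⊆⇒length≤ : {xs ys : List A} → Unique xs → (∀ {x} → x ∈ xs → x ∈ ys) →
                   length xs ≤ length ys
Unique∧⊆⇒length≤ [] _ = z≤n
Unique∧⊆⇒length≤ {xs = x ∷ xs} {ys} (x∉xs ∷ xs!) ⊆ys
  with zs , ys↭ ← ∈⇒↭ (⊆ys (here refl)) = begin
    suc (length xs) ≤⟨ s≤s (Unique∧⊆⇒length≤ xs! ⊆zs) ⟩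
    suc (length zs) ≡⟨ ↭-length ys↭ ⟨
    length ys       ∎
  where
  open ≤-Reasoning
  ⊆zs : ∀ {y} → y ∈ xs → y ∈ zs
  ⊆zs y∈xs with ∈-resp-↭ ys↭ (⊆ys (there y∈xs))
  ... | here refl = contradiction refl (All.lookup x∉xs y∈xs)
  ... | there y∈zs = y∈zs

-- Depth-first search

module DepthFirst (_~_ : Rel A 0ℓ) (_~?_ : Decidable _~_) (~-sym : Symmetric _~_) (n : ℕ) where

  record IsPath (us : List A) : Set where
    field
      linked  : Linked _~_ us
      unique  : Unique us
      length≡ : length us ≡ n

  -- `few` says that there are at most ⌈m/n⌉ bags, written without division. The case `u ≡ v` asks
  -- that each single vertex lies in a bag, because the pairs chosen for the host graph may be
  -- loops.
  record EdgeCover (m : ℕ) (V : A → Set) : Set where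
    field
      bags   : List (List A)
      small  : All (λ X → length X ≤ n + n) bags
      few    : length bags * n < m + n
      covers : ∀ {u v} → V u → V v → u ≡ v ⊎ u ~ v → Any (λ X → u ∈ X × v ∈ X) bags
  open EdgeCover

  -- A state of the search: ps are the vertices finished since the last bag was
  -- emitted, us is the stack and ts are the unvisited vertices.
  Remaining : (ps us ts : List A) → A → Set
  Remaining ps us ts v = v ∈ ps ⊎ v ∈ us ⊎ v ∈ ts

  total : (ps us ts : List A) → ℕ
  total ps us ts = length ps + (length us + length ts)

  Result : (ps us ts : List A) → Set
  Result ps us ts = (∃[ vs ] IsPath vs) ⊎ EdgeCover (total ps us ts) (Remaining ps us ts)

  weaken : ∀ {m m′ V V′} → m ≡ m′ → (∀ {v} → V′ v → V v) → EdgeCover m V → EdgeCover m′ V′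
  weaken refl V′⊆V C = record
    { bags = bags C ; small = small C ; few = few C
    ; covers = λ u v → covers C (V′⊆V u) (V′⊆V v) }

  -- The fewer than `n` vertices finished since the last bag form a final bag. If there are none, no
  -- bag may be added: it would turn `few` into the false `1 * n < 0 + n`.
  finish : ∀ ps → length ps < n → EdgeCover (total ps [] []) (Remaining ps [] [])
  finish [] 0<n = record
    { bags = [] ; small = [] ; few = 0<n
    ; covers = λ { (inj₁ ()) ; (inj₂ (inj₁ ())) ; (inj₂ (inj₂ ())) } }
  finish ps@(_ ∷ _) p<n = record
    { bags = ps ∷ []
    ; small = ≤-trans (<⇒≤ p<n) (m≤m+n n n) ∷ []
    ; few = subst (_< total ps [] [] + n) (sym (+-identityʳ n)) (m<n+m n z<s)
    ; covers = λ u v _ → here (inPs u , inPs v) }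
    where
    inPs : ∀ {v} → Remaining ps [] [] v → v ∈ ps
    inPs (inj₁ v∈ps) = v∈ps
    inPs (inj₂ (inj₁ ()))
    inPs (inj₂ (inj₂ ()))

  -- The bag `ps ++ us` handles every pair with an end in `ps`, since by `sep` the other end is not
  -- in `ts`. The stack is kept for later bags, and the `n` vertices of `ps` pay for this one in
  -- `few`.
  emit : ∀ ps us ts → length ps ≡ n → length us < n → (∀ {u v} → u ∈ ps → v ∈ ts → ¬ u ~ v) →
         EdgeCover (total [] us ts) (Remaining [] us ts) →
         EdgeCover (total ps us ts) (Remaining ps us ts)
  emit ps us ts p≡n u<n sep C = record
    { bags = (ps ++ us) ∷ bags C
    ; small = subst (_≤ n + n) (sym (length-++ ps)) (+-mono-≤ (≤-reflexive p≡n) (<⇒≤ u<n)) ∷ small C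
    ; few = subst (λ p → n + length (bags C) * n < p + (length us + length ts) + n) (sym p≡n)
        (subst (n + length (bags C) * n <_) (sym (+-assoc n (length us + length ts) n))
          (+-monoʳ-< n (few C)))
    ; covers = cov }
    where
    Covered : A → A → Set
    Covered u v = Any (λ X → u ∈ X × v ∈ X) ((ps ++ us) ∷ bags C)
    cov : ∀ {u v} → Remaining ps us ts u → Remaining ps us ts v → u ≡ v ⊎ u ~ v → Covered u v
    cov (inj₁ u)        (inj₁ v)        _ = here (∈-++⁺ˡ u , ∈-++⁺ˡ v)
    cov (inj₁ u)        (inj₂ (inj₁ v)) _ = here (∈-++⁺ˡ u , ∈-++⁺ʳ ps v)
    cov (inj₁ u)        (inj₂ (inj₂ v)) (inj₁ refl) = here (∈-++⁺ˡ u , ∈-++⁺ˡ u)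
    cov (inj₁ u)        (inj₂ (inj₂ v)) (inj₂ u~v) = contradiction u~v (sep u v)
    cov (inj₂ (inj₁ u)) (inj₁ v)        _ = here (∈-++⁺ʳ ps u , ∈-++⁺ˡ v)
    cov (inj₂ (inj₂ u)) (inj₁ v)        (inj₁ refl) = here (∈-++⁺ˡ v , ∈-++⁺ˡ v)
    cov (inj₂ (inj₂ u)) (inj₁ v)        (inj₂ u~v) = contradiction (~-sym u~v) (sep v u)
    cov (inj₂ u)        (inj₂ v)        e = there (covers C (inj₂ u) (inj₂ v) e)

  -- Each vertex is pushed once and popped once, which bounds the steps left by |us| + 2|ts|.
  search : ∀ fuel ps us ts → length us + (length ts + length ts) ≤ fuel →
           length ps < n → length us < n → Linked _~_ us → Unique (us ++ ts) →
           (∀ {u v} → u ∈ ps → v ∈ ts → ¬ u ~ v) → Result ps us ts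

  -- The stack is always a path of the graph, so a push that brings it to `n` vertices ends the
  -- search.
  push : ∀ fuel ps u us ts → length (u ∷ us) + (length ts + length ts) ≤ fuel →
         length ps < n → length us < n → Linked _~_ (u ∷ us) → Unique (u ∷ us ++ ts) →
         (∀ {u v} → u ∈ ps → v ∈ ts → ¬ u ~ v) → Result ps (u ∷ us) ts
  push fuel ps u us ts enough p<n u<n linked unique sep with m≤n⇒m<n∨m≡n u<n
  ... | inj₁ u<n′ = search fuel ps (u ∷ us) ts enough p<n u<n′ linked unique sep
  ... | inj₂ u≡n = inj₁ (u ∷ us , record
    { linked = linked ; unique = Unique-++⁻ˡ (u ∷ us) unique ; length≡ = u≡n })

  pop : ∀ fuel ps u us ts → length us + (length ts + length ts) ≤ fuel →
        length ps < n → length us < n → Linked _~_ us → Unique (us ++ ts) →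
        (∀ {u v} → u ∈ ps → v ∈ ts → ¬ u ~ v) → (∀ {v} → v ∈ ts → ¬ u ~ v) → Result ps (u ∷ us) ts
  pop fuel ps u us ts enough p<n u<n linked unique sep sepᵤ =
    map₂ (weaken (sym (+-suc (length ps) (length us + length ts))) moved) popped
    where
    moved : ∀ {v} → Remaining ps (u ∷ us) ts v → Remaining (u ∷ ps) us ts v
    moved (inj₁ v)                = inj₁ (there v)
    moved (inj₂ (inj₁ (here v)))  = inj₁ (here v)
    moved (inj₂ (inj₁ (there v))) = inj₂ (inj₁ v)
    moved (inj₂ (inj₂ v))         = inj₂ (inj₂ v)
    sep′ : ∀ {w v} → w ∈ u ∷ ps → v ∈ ts → ¬ w ~ v
    sep′ (here refl) = sepᵤ
    sep′ (there w)   = sep w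
    popped : Result (u ∷ ps) us ts
    popped with m≤n⇒m<n∨m≡n p<n
    ... | inj₁ p<n′ = search fuel (u ∷ ps) us ts enough p<n′ u<n linked unique sep′
    ... | inj₂ p≡n = map₂ (emit (u ∷ ps) us ts p≡n u<n sep′)
      (search fuel [] us ts enough (≤-<-trans z≤n p<n) u<n linked unique λ ())

  search _ ps [] [] _ p<n _ _ _ _ = inj₂ (finish ps p<n)
  search (suc fuel) ps [] (t ∷ ts) (s≤s enough) p<n u<n _ unique sep =
    map₂ (weaken refl moved) (push fuel ps t [] ts (subst (_≤ fuel) (+-suc _ _) enough) p<n u<n [-] unique
      (λ u v → sep u (there v)))
    where
    moved : ∀ {v} → Remaining ps [] (t ∷ ts) v → Remaining ps (t ∷ []) ts v
    moved (inj₁ v)                = inj₁ v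
    moved (inj₂ (inj₁ ()))
    moved (inj₂ (inj₂ (here v)))  = inj₂ (inj₁ (here v))
    moved (inj₂ (inj₂ (there v))) = inj₂ (inj₂ v)
  search (suc fuel) ps (u ∷ us) ts (s≤s enough) p<n u<n linked unique@(_ ∷ unique′) sep with
    any? (u ~?_) ts
  ... | no ¬u~ = pop fuel ps u us ts enough p<n (<⇒≤ u<n) (tail linked) unique′ sep
                   (All.lookup (¬Any⇒All¬ ts ¬u~))
  ... | yes u~ with t , t∈ts , u~t ← find u~ with ts′ , ts↭ ← ∈⇒↭ t∈ts =
    map₂ (weaken total≡ moved) (push fuel ps t (u ∷ us) ts′ enough′ p<n u<n (~-sym u~t ∷ linked)
      (Unique-resp-↭ (↭-trans (++⁺ˡ (u ∷ us) ts↭) (shift t (u ∷ us) ts′)) unique)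
      (λ u v → sep u (∈-resp-↭ (↭-sym ts↭) (there v))))
    where
    length-ts : length ts ≡ suc (length ts′)
    length-ts = ↭-length ts↭
    enough′ : suc (suc (length us) + (length ts′ + length ts′)) ≤ fuel
    enough′ = subst (_≤ fuel)
      (trans (cong (λ k → length us + (k + k)) length-ts) (lemma (length us) (length ts′))) enough
      where
      lemma : ∀ a b → a + (suc b + suc b) ≡ suc (suc a + (b + b))
      lemma = solve-∀
    total≡ : total ps (t ∷ u ∷ us) ts′ ≡ total ps (u ∷ us) ts
    total≡ = cong (length ps +_)
      (trans (sym (+-suc (suc (length us)) (length ts′))) (cong (suc (length us) +_) (sym length-ts)))
    moved : ∀ {v} → Remaining ps (u ∷ us) ts v → Remaining ps (t ∷ u ∷ us) ts′ v
    moved (inj₁ v)        = inj₁ v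
    moved (inj₂ (inj₁ v)) = inj₂ (inj₁ (there v))
    moved (inj₂ (inj₂ v)) with ∈-resp-↭ ts↭ v
    ... | here v≡t  = inj₂ (inj₁ (here v≡t))
    ... | there v∈ts′ = inj₂ (inj₂ v∈ts′)

  path-or-cover : ∀ ts → 0 < n → Unique ts →
                  (∃[ vs ] IsPath vs) ⊎ EdgeCover (length ts) (_∈ ts)
  path-or-cover ts 0<n ts! = map₂ (weaken refl (inj₂ ∘ inj₂))
    (search _ [] [] ts ≤-refl 0<n 0<n [] ts! λ ())

-- A sequence of pairs that is sparse inside every small set

∑ : (A → ℕ) → List A → ℕ
∑ f xs = ∑ᴸ (map f xs)

∑-mono : ∀ {f g : A → ℕ} xs → (∀ {x} → x ∈ xs → f x ≤ g x) → ∑ f xs ≤ ∑ g xs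
∑-mono []       _   = z≤n
∑-mono (x ∷ xs) f≤g = +-mono-≤ (f≤g (here refl)) (∑-mono xs (f≤g ∘ there))

∑-+ : ∀ (f g : A → ℕ) xs → ∑ (λ x → f x + g x) xs ≡ ∑ f xs + ∑ g xs
∑-+ f g []       = refl
∑-+ f g (x ∷ xs) rewrite ∑-+ f g xs = lemma (f x) (g x) (∑ f xs) (∑ g xs)
  where
  lemma : ∀ a b c d → a + b + (c + d) ≡ a + c + (b + d)
  lemma = solve-∀

∑-*ˡ : ∀ c (f : A → ℕ) xs → ∑ (λ x → c * f x) xs ≡ c * ∑ f xs
∑-*ˡ c f []       = sym (*-zeroʳ c)
∑-*ˡ c f (x ∷ xs) rewrite ∑-*ˡ c f xs = sym (*-distribˡ-+ c (f x) (∑ f xs))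

∑-const : ∀ c (xs : List A) → ∑ (λ _ → c) xs ≡ length xs * c
∑-const c []       = refl
∑-const c (x ∷ xs) = cong (c +_) (∑-const c xs)

∑-swap : ∀ (f : A → B → ℕ) xs ys →
         ∑ (λ x → ∑ (f x) ys) xs ≡ ∑ (λ y → ∑ (λ x → f x y) xs) ys
∑-swap f []       ys = sym (trans (∑-const 0 ys) (*-zeroʳ (length ys)))
∑-swap f (x ∷ xs) ys rewrite ∑-swap f xs ys = sym (∑-+ (f x) _ ys)

f[x]≤∑ : ∀ (f : A → ℕ) {x xs} → x ∈ xs → f x ≤ ∑ f xs
f[x]≤∑ f (here refl)      = m≤m+n (f _) _
f[x]≤∑ f (there {x} x∈xs) = ≤-trans (f[x]≤∑ f x∈xs) (m≤n+m _ (f x))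

-- The minimum is taken over `xs` together with the default `x₀`, so the result may be `x₀` even if
-- that is outside `xs`.
below-average : A → ∀ (f : A → ℕ) xs → ∃[ x ] length xs * f x ≤ ∑ f xs
below-average x₀ f xs = x* , subst (_≤ ∑ f xs) (∑-const (f x*) xs)
  (∑-mono xs (All.lookup (f[argmin]≤f[xs] {f = f} x₀ xs)))
  where x* = argmin f x₀ xs

module Greedy {P S : Set} {Inside : REL S P 0ℓ} (inside? : ∀ X → U.Decidable (Inside X)) where

  count : S → List P → ℕ
  count X ps = length (filter (inside? X) ps)

  count-mono : ∀ {X Y} → (∀ {p} → Inside X p → Inside Y p) → ∀ ps → count X ps ≤ count Y ps
  count-mono         X⊆Y [] = z≤n
  count-mono {X} {Y} X⊆Y (p ∷ ps) with inside? X p | inside? Y p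
  ... | yes _ | yes _   = s≤s (count-mono X⊆Y ps)
  ... | yes p∈X | no p∉Y = contradiction (X⊆Y p∈X) p∉Y
  ... | no _  | yes _   = m≤n⇒m≤1+n (count-mono X⊆Y ps)
  ... | no _  | no _    = count-mono X⊆Y ps

  -- `sparse` bounds the probability that a random entry of `ps` lies in `X` by 1/(qb). A pair
  -- inside `X` multiplies the weight of `X` by b + 1, so the expected growth factor is at most 1 +
  -- b/(qb) = 1 + 1/q.
  module _ (b q : ℕ) (𝓕 : List S) (p₀ : P) (ps : List P) .{{_ : NonZero (length ps)}}
           (sparse : ∀ {X} → X ∈ 𝓕 → q * (b * count X ps) ≤ length ps) where

    weight : List P → S → ℕ
    weight es X = suc b ^ count X es

    potential : List P → ℕ
    potential es = ∑ (weight es) 𝓕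

    weight-∑ : ∀ X es qs → ∑ (λ p → weight (p ∷ es) X) qs ≡ weight es X * (length qs + b * count X qs)
    weight-∑ X es [] = sym (trans (cong (weight es X *_) (*-zeroʳ b)) (*-zeroʳ (weight es X)))
    weight-∑ X es (p ∷ qs) with does (inside? X p)
    ... | true  = trans (cong (suc b * weight es X +_) (weight-∑ X es qs))
                        (lemma b (weight es X) (length qs) (count X qs))
      where
      lemma : ∀ b w l c → suc b * w + w * (l + b * c) ≡ w * (suc l + b * suc c)
      lemma = solve-∀
    ... | false = trans (cong (weight es X +_) (weight-∑ X es qs))
                        (lemma (weight es X) (length qs) (b * count X qs))
      where
      lemma : ∀ w l c → w + w * (l + c) ≡ w * (suc l + c)
      lemma = solve-∀

    ∑-potential : ∀ es → q * ∑ (λ p → potential (p ∷ es)) ps ≤ length ps * (suc q * potential es)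
    ∑-potential es = begin
      q * ∑ (λ p → potential (p ∷ es)) ps
        ≡⟨ cong (q *_) (∑-swap (λ p → weight (p ∷ es)) ps 𝓕) ⟩
      q * ∑ (λ X → ∑ (λ p → weight (p ∷ es) X) ps) 𝓕
        ≡⟨ ∑-*ˡ q _ 𝓕 ⟨
      ∑ (λ X → q * ∑ (λ p → weight (p ∷ es) X) ps) 𝓕
        ≤⟨ ∑-mono 𝓕 bound ⟩
      ∑ (λ X → length ps * suc q * weight es X) 𝓕
        ≡⟨ ∑-*ˡ (length ps * suc q) (weight es) 𝓕 ⟩
      length ps * suc q * potential es
        ≡⟨ *-assoc (length ps) (suc q) (potential es) ⟩
      length ps * (suc q * potential es) ∎
      where
      open ≤-Reasoning
      bound : ∀ {X} → X ∈ 𝓕 → q * ∑ (λ p → weight (p ∷ es) X) ps ≤ length ps * suc q * weight es X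
      bound {X} X∈𝓕 = begin
        q * ∑ (λ p → weight (p ∷ es) X) ps
          ≡⟨ cong (q *_) (weight-∑ X es ps) ⟩
        q * (weight es X * (length ps + b * count X ps))
          ≡⟨ lemma q (weight es X) (length ps) (b * count X ps) ⟩
        (q * length ps + q * (b * count X ps)) * weight es X
          ≤⟨ *-monoˡ-≤ (weight es X) (+-monoʳ-≤ (q * length ps) (sparse X∈𝓕)) ⟩
        (q * length ps + length ps) * weight es X
          ≡⟨ cong (_* weight es X) (lemma′ q (length ps)) ⟩
        length ps * suc q * weight es X ∎
        where
        lemma : ∀ q w l c → q * (w * (l + c)) ≡ (q * l + q * c) * w
        lemma = solve-∀
        lemma′ : ∀ q l → q * l + l ≡ l * suc q
        lemma′ = solve-∀

    -- Method of conditional expectations: some choice is no worse than the average, which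
    -- `∑-potential` bounds by (q + 1)/q times the old potential.
    extend : ∀ es → ∃[ p ] q * potential (p ∷ es) ≤ suc q * potential es
    extend es with p , below ← below-average p₀ (λ p → potential (p ∷ es)) ps =
      p , *-cancelˡ-≤ (length ps) (begin
        length ps * (q * potential (p ∷ es))
          ≡⟨ x∙yz≈y∙xz (length ps) q _ ⟩
        q * (length ps * potential (p ∷ es))
          ≤⟨ *-monoʳ-≤ q below ⟩
        q * ∑ (λ p → potential (p ∷ es)) ps
          ≤⟨ ∑-potential es ⟩
        length ps * (suc q * potential es) ∎)
      where
      open ≤-Reasoning

    -- Iterates `extend` from the empty sequence, where every weight is 1 and the potential is
    -- `length 𝓕`. The factor (1 + 1/q)^M is kept as two powers.
    low-potential : ∀ M → ∃[ es ] length es ≡ M × q ^ M * potential es ≤ suc q ^ M * length 𝓕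
    low-potential zero = [] , refl , ≤-reflexive (cong (_+ 0) (trans (∑-const 1 𝓕) (*-identityʳ (length 𝓕))))
    low-potential (suc M) with es , refl , IH ← low-potential M with p , step ← extend es =
      p ∷ es , refl , (begin
        q * q ^ M * potential (p ∷ es)       ≡⟨ xy∙z≈y∙xz q (q ^ M) _ ⟩
        q ^ M * (q * potential (p ∷ es))     ≤⟨ *-monoʳ-≤ (q ^ M) step ⟩
        q ^ M * (suc q * potential es)       ≡⟨ x∙yz≈y∙xz (q ^ M) (suc q) _ ⟩
        suc q * (q ^ M * potential es)       ≤⟨ *-monoʳ-≤ (suc q) IH ⟩
        suc q * (suc q ^ M * length 𝓕)       ≡⟨ *-assoc (suc q) (suc q ^ M) _ ⟨
        suc q * suc q ^ M * length 𝓕         ∎)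
      where
      open ≤-Reasoning

    -- The weight of a single set is a summand of the potential and inherits its bound.
    sparse-sequence : ∀ M → ∃[ es ] length es ≡ M ×
      (∀ {X} → X ∈ 𝓕 → q ^ M * suc b ^ count X es ≤ suc q ^ M * length 𝓕)
    sparse-sequence M with es , |es|≡M , bound ← low-potential M =
      es , |es|≡M , λ X∈𝓕 → ≤-trans (*-monoʳ-≤ (q ^ M) (f[x]≤∑ (weight es) X∈𝓕)) bound

  -- The pairs inside the first bag are charged to it and deleted; the remaining pairs lie in the
  -- other bags, whose counts can only drop.
  length≤bags*bound : ∀ {g} es (𝓑 : List S) → (∀ {p} → p ∈ es → Any (λ X → Inside X p) 𝓑) →
               (∀ {X} → X ∈ 𝓑 → count X es ≤ g) → length es ≤ length 𝓑 * g
  length≤bags*bound []       []      _      _ = z≤n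
  length≤bags*bound (p ∷ es) []      covers _ with () ← covers (here refl)
  length≤bags*bound {g} es (X ∷ 𝓑) covers light = begin
    length es                      ≡⟨ split es ⟩
    count X es + length (rest es)  ≤⟨ +-mono-≤ (light (here refl)) (length≤bags*bound (rest es) 𝓑 covers′ light′) ⟩
    g + length 𝓑 * g               ∎
    where
    open ≤-Reasoning
    rest : List P → List P
    rest = filter (¬? ∘ inside? X)
    split : ∀ ps → length ps ≡ count X ps + length (rest ps)
    split [] = refl
    split (p ∷ ps) with does (inside? X p)
    ... | true  = cong suc (split ps)
    ... | false = trans (cong suc (split ps)) (sym (+-suc _ _))
    covers′ : ∀ {p} → p ∈ rest es → Any (λ Y → Inside Y p) 𝓑
    covers′ p∈ with p∈es , p∉X ← ∈-filter⁻ (¬? ∘ inside? X) {xs = es} p∈ with covers p∈es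
    ... | here p∈X = contradiction p∈X p∉X
    ... | there c  = c
    count-rest : ∀ Y ps → count Y (rest ps) ≤ count Y ps
    count-rest Y [] = z≤n
    count-rest Y (p ∷ ps) with does (inside? X p)
    ... | false with does (inside? Y p)
    ...   | true  = s≤s (count-rest Y ps)
    ...   | false = count-rest Y ps
    count-rest Y (p ∷ ps) | true with does (inside? Y p)
    ...   | true  = m≤n⇒m≤1+n (count-rest Y ps)
    ...   | false = count-rest Y ps
    light′ : ∀ {Y} → Y ∈ 𝓑 → count Y (rest es) ≤ g
    light′ {Y} Y∈𝓑 = ≤-trans (count-rest Y es) (light (there Y∈𝓑))

-- Counting short sublists

sublists≤ : List A → ℕ → List (List A)
sublists≤ []       _       = [] ∷ []
sublists≤ (x ∷ xs) zero    = [] ∷ []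
sublists≤ (x ∷ xs) (suc s) = map (x ∷_) (sublists≤ xs s) ++ sublists≤ xs (suc s)

∈sublists≤⇒length≤ : ∀ {X : List A} xs s → X ∈ sublists≤ xs s → length X ≤ s
∈sublists≤⇒length≤ []       _       (here refl) = z≤n
∈sublists≤⇒length≤ (x ∷ xs) zero    (here refl) = z≤n
∈sublists≤⇒length≤ (x ∷ xs) (suc s) X∈ with ∈-++⁻ (map (x ∷_) (sublists≤ xs s)) X∈
... | inj₂ X∈ʳ = ∈sublists≤⇒length≤ xs (suc s) X∈ʳ
... | inj₁ X∈ˡ with Y , Y∈ , refl ← ∈-map⁻ (x ∷_) X∈ˡ = s≤s (∈sublists≤⇒length≤ xs s Y∈)

filter∈sublists≤ : ∀ {Q : A → Set} (Q? : U.Decidable Q) xs s →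
                   length (filter Q? xs) ≤ s → filter Q? xs ∈ sublists≤ xs s
filter∈sublists≤ Q? []       s       _ = here refl
filter∈sublists≤ Q? (x ∷ xs) s       ≤s with does (Q? x)
filter∈sublists≤ Q? (x ∷ xs) (suc s) (s≤s ≤s) | true =
  ∈-++⁺ˡ (∈-map⁺ (x ∷_) (filter∈sublists≤ Q? xs s ≤s))
filter∈sublists≤ Q? (x ∷ xs) (suc s) ≤s | false =
  ∈-++⁺ʳ (map (x ∷_) (sublists≤ xs s)) (filter∈sublists≤ Q? xs (suc s) ≤s)
filter∈sublists≤ Q? (x ∷ xs) zero    ≤0 | false with [] ← filter Q? xs = here refl

-- Weighting each sublist X by k^(length xs - length X) gives total weight (k + 1)^(length xs).
length-sublists≤ : ∀ k .{{_ : NonZero k}} (xs : List A) s →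
  length (sublists≤ xs s) * k ^ length xs ≤ suc k ^ length xs * k ^ s
length-sublists≤ k []       s = subst (1 ≤_) (sym (+-identityʳ (k ^ s))) (m^n>0 k s)
length-sublists≤ k (x ∷ xs) zero = begin
  k ^ length (x ∷ xs) + 0         ≤⟨ +-monoˡ-≤ 0 (^-monoˡ-≤ (length (x ∷ xs)) (n≤1+n k)) ⟩
  suc k ^ length (x ∷ xs) + 0     ≡⟨ trans (+-identityʳ _) (sym (*-identityʳ _)) ⟩
  suc k ^ length (x ∷ xs) * 1     ∎
  where open ≤-Reasoning
length-sublists≤ k (x ∷ xs) (suc s) = begin
  length (map (x ∷_) (sublists≤ xs s) ++ sublists≤ xs (suc s)) * (k * k ^ length xs)
    ≡⟨ cong (_* (k * k ^ length xs)) (trans (length-++ (map (x ∷_) (sublists≤ xs s)))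
         (cong (_+ b) (length-map (x ∷_) (sublists≤ xs s)))) ⟩
  (a + b) * (k * k ^ length xs)
    ≡⟨ lemma a b k (k ^ length xs) ⟩
  k * (a * k ^ length xs) + k * (b * k ^ length xs)
    ≤⟨ +-mono-≤ (*-monoʳ-≤ k (length-sublists≤ k xs s)) (*-monoʳ-≤ k (length-sublists≤ k xs (suc s))) ⟩
  k * (suc k ^ length xs * k ^ s) + k * (suc k ^ length xs * (k * k ^ s))
    ≡⟨ lemma′ k (suc k ^ length xs) (k ^ s) ⟩
  suc k * suc k ^ length xs * (k * k ^ s) ∎
  where
  open ≤-Reasoning
  a b : ℕ
  a = length (sublists≤ xs s)
  b = length (sublists≤ xs (suc s))
  lemma : ∀ a b k z → (a + b) * (k * z) ≡ k * (a * z) + k * (b * z)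
  lemma = solve-∀
  lemma′ : ∀ k y z → k * (y * z) + k * (y * (k * z)) ≡ suc k * y * (k * z)
  lemma′ = solve-∀

-- Estimates for powers

^-distribʳ-* : ∀ n x y → (x * y) ^ n ≡ x ^ n * y ^ n
^-distribʳ-* zero    x y = refl
^-distribʳ-* (suc n) x y rewrite ^-distribʳ-* n x y = lemma x y (x ^ n) (y ^ n)
  where
  lemma : ∀ a b c d → a * b * (c * d) ≡ a * c * (b * d)
  lemma = solve-∀

-- (1 + 1/k)^j ≤ 1 / (1 - j/(k+1)), with d = k + 1 - j.
bernoulli : ∀ {k d} j → j + d ≡ suc k → suc k ^ j * d ≤ k ^ j * suc k
bernoulli zero refl = ≤-refl
bernoulli {k} {d} (suc j) eq = begin
  suc k * suc k ^ j * d     ≡⟨ lemma (suc k) (suc k ^ j) d ⟩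
  suc k ^ j * (d + k * d)   ≤⟨ *-monoʳ-≤ (suc k ^ j) (+-monoˡ-≤ (k * d) d≤k) ⟩
  suc k ^ j * (k + k * d)   ≡⟨ lemma′ (suc k ^ j) k d ⟩
  k * (suc k ^ j * suc d)   ≤⟨ *-monoʳ-≤ k (bernoulli j (trans (+-suc j d) eq)) ⟩
  k * (k ^ j * suc k)       ≡⟨ *-assoc k (k ^ j) (suc k) ⟨
  k * k ^ j * suc k         ∎
  where
  open ≤-Reasoning
  d≤k : d ≤ k
  d≤k = subst (d ≤_) (suc-injective eq) (m≤n+m d j)
  lemma : ∀ a b d → a * b * d ≡ b * (a * d)
  lemma = solve-∀
  lemma′ : ∀ a k d → a * (k + k * d) ≡ k * (a * suc d)
  lemma′ = solve-∀

^-scaled-mono-≤ : ∀ m a b x y → a * x ≤ b * y → a ^ m * x ^ m ≤ b ^ m * y ^ m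
^-scaled-mono-≤ m a b x y ax≤by =
  subst₂ _≤_ (^-distribʳ-* m a x) (^-distribʳ-* m b y) (^-monoˡ-≤ m ax≤by)

*-cancel-ratio-≤ : ∀ c a b x y .{{_ : NonZero a}} → b ≤ a * c → a * x ≤ b * y → x ≤ c * y
*-cancel-ratio-≤ c a b x y b≤ac ax≤by = *-cancelˡ-≤ a (begin
  a * x          ≤⟨ ax≤by ⟩
  b * y          ≤⟨ *-monoˡ-≤ y b≤ac ⟩
  a * c * y      ≡⟨ *-assoc a c y ⟩
  a * (c * y)    ∎)
  where open ≤-Reasoning

-- `bernoulli` with d = 7j + 1 bounds the ratio of the powers by (8j + 1)/(7j + 1), which is at most
-- 8/7.
7*[1+k]^j≤8*k^j : ∀ j → let k = 8 * j in 7 * suc k ^ j ≤ 8 * k ^ j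
7*[1+k]^j≤8*k^j j = *-cancelʳ-≤ _ _ (suc (7 * j)) (begin
  7 * suc k ^ j * suc (7 * j)      ≡⟨ *-assoc 7 (suc k ^ j) _ ⟩
  7 * (suc k ^ j * suc (7 * j))    ≤⟨ *-monoʳ-≤ 7 (bernoulli j (+-suc j (7 * j))) ⟩
  -- 8(7j + 1) exceeds 7(8j + 1) by exactly 1.
  7 * (k ^ j * suc k)              ≤⟨ m≤m+n _ (k ^ j) ⟩
  7 * (k ^ j * suc k) + k ^ j      ≡⟨ lemma (k ^ j) j ⟩
  8 * k ^ j * suc (7 * j)          ∎)
  where
  open ≤-Reasoning
  k : ℕ
  k = 8 * j
  lemma : ∀ y j → 7 * (y * suc (8 * j)) + y ≡ 8 * y * suc (7 * j)
  lemma = solve-∀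

-- (1 + 1/k)^k ≤ (8/7)^8 ≤ 3 for k = 8j.
[1+k]^k≤3*k^k : ∀ j → let k = 8 * j in suc k ^ k ≤ 3 * k ^ k
[1+k]^k≤3*k^k j = subst (λ m → suc k ^ m ≤ 3 * k ^ m) (*-comm j 8)
  (subst₂ (λ x y → x ≤ 3 * y) (^-*-assoc (suc k) j 8) (^-*-assoc k j 8)
    (*-cancel-ratio-≤ 3 (7 ^ 8) (8 ^ 8) ((suc k ^ j) ^ 8) ((k ^ j) ^ 8) (≤ᵇ⇒≤ (8 ^ 8) (7 ^ 8 * 3) tt)
      (^-scaled-mono-≤ 8 7 8 (suc k ^ j) (k ^ j) (7*[1+k]^j≤8*k^j j))))
  where
  k : ℕ
  k = 8 * j

[1+k]^[kx]≤3^x*k^[kx] : ∀ j x → let k = 8 * j in suc k ^ (k * x) ≤ 3 ^ x * k ^ (k * x)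
[1+k]^[kx]≤3^x*k^[kx] j x = begin
  suc k ^ (k * x)         ≡⟨ ^-*-assoc (suc k) k x ⟨
  (suc k ^ k) ^ x         ≤⟨ ^-monoˡ-≤ x ([1+k]^k≤3*k^k j) ⟩
  (3 * k ^ k) ^ x         ≡⟨ ^-distribʳ-* x 3 (k ^ k) ⟩
  3 ^ x * (k ^ k) ^ x     ≡⟨ cong (3 ^ x *_) (^-*-assoc k k x) ⟩
  3 ^ x * k ^ (k * x)     ∎
  where
  open ≤-Reasoning
  k = 8 * j

length-cartesianProduct : (xs : List A) (ys : List B) →
                          length (cartesianProduct xs ys) ≡ length xs * length ys
length-cartesianProduct []       ys = refl
length-cartesianProduct (x ∷ xs) ys = trans (length-++ (map (x ,_) ys))
  (cong₂ _+_ (length-map (x ,_) ys) (length-cartesianProduct xs ys))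

-- Takes k = 8r in `length-sublists≤`, the ratio of `length xs` to `s`. This is the usual estimate
-- (eN/s)^s for the number of small sets, with 3 in place of e.
length-sublists≤-bound : ∀ r s .{{_ : NonZero r}} (xs : List A) → length xs ≡ 8 * r * s →
  length (sublists≤ xs s) ≤ (3 * (8 * r)) ^ s
length-sublists≤-bound r s xs |xs| = *-cancelʳ-≤ _ _ (k ^ length xs) (begin
  length (sublists≤ xs s) * k ^ length xs   ≤⟨ length-sublists≤ k xs s ⟩
  suc k ^ length xs * k ^ s                 ≤⟨ *-monoˡ-≤ (k ^ s) power ⟩
  3 ^ s * k ^ length xs * k ^ s             ≡⟨ xy∙z≈xz∙y (3 ^ s) _ _ ⟩
  3 ^ s * k ^ s * k ^ length xs             ≡⟨ cong (_* k ^ length xs) (^-distribʳ-* s 3 k) ⟨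
  (3 * k) ^ s * k ^ length xs               ∎)
  where
  open ≤-Reasoning
  k : ℕ
  k = 8 * r
  instance
    k≢0 : NonZero k
    k≢0 = m*n≢0 8 r
    k^≢0 : NonZero (k ^ length xs)
    k^≢0 = m^n≢0 k (length xs)
  power : suc k ^ length xs ≤ 3 ^ s * k ^ length xs
  power = subst (λ l → suc k ^ l ≤ 3 ^ s * k ^ l) (sym |xs|) ([1+k]^[kx]≤3^x*k^[kx] r s)

-- Since 96² = 9216, one factor b absorbs this constant and one factor a. Each of the other `L`
-- factors absorbs 4a, the 4^L coming from (2^L)².
square*power< : ∀ a b L → 9216 * a < b → 4 * a ≤ b → .{{_ : NonZero b}} →
  (96 * 2 ^ L) ^ 2 * a ^ suc L < b ^ suc L
square*power< a b L 9216a<b 4a≤b = begin-strict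
  (96 * 2 ^ L) ^ 2 * a ^ suc L           ≡⟨ lemma (2 ^ L) a (a ^ L) ⟩
  9216 * a * (2 ^ L * 2 ^ L * a ^ L)     ≡⟨ cong (λ x → 9216 * a * (x * a ^ L)) (^-distribʳ-* L 2 2) ⟨
  9216 * a * (4 ^ L * a ^ L)             ≡⟨ cong (9216 * a *_) (^-distribʳ-* L 4 a) ⟨
  9216 * a * (4 * a) ^ L                 ≤⟨ *-monoʳ-≤ (9216 * a) (^-monoˡ-≤ L 4a≤b) ⟩
  9216 * a * b ^ L                       <⟨ *-monoˡ-< (b ^ L) {{m^n≢0 b L}} 9216a<b ⟩
  b * b ^ L                              ∎
  where
  open ≤-Reasoning
  lemma : ∀ z a y → (96 * z) * (96 * z * 1) * (a * y) ≡ 9216 * a * (z * z * y)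
  lemma = solve-∀

-- The constants work because 9·64·16·3^18 < 5^18; the factor 16 comes from r² < 4·4^L.
[24r]^2*3^18L<5^18L : ∀ r L .{{_ : NonZero L}} → r < 2 ^ suc L →
  (3 * (8 * r)) ^ 2 * 3 ^ (18 * L) < 5 ^ (18 * L)
[24r]^2*3^18L<5^18L r (suc L) r<2^ = subst₂ _<_
  (cong ((3 * (8 * r)) ^ 2 *_) (^-*-assoc 3 18 (suc L))) (^-*-assoc 5 18 (suc L))
  (≤-<-trans (*-monoˡ-≤ ((3 ^ 18) ^ suc L) (^-monoˡ-≤ 2 24r≤))
    (square*power< (3 ^ 18) (5 ^ 18) L (<ᵇ⇒< (9216 * 3 ^ 18) (5 ^ 18) tt)
      (≤ᵇ⇒≤ (4 * 3 ^ 18) (5 ^ 18) tt)))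
  where
  24r≤ : 3 * (8 * r) ≤ 96 * 2 ^ L
  24r≤ = subst (3 * (8 * r) ≤_) (lemma (2 ^ L)) (*-monoʳ-≤ 3 (*-monoʳ-≤ 8 (<⇒≤ r<2^)))
    where
    lemma : ∀ z → 3 * (8 * (2 * (2 * z))) ≡ 96 * z
    lemma = solve-∀

-- Sparse sequences of vertex pairs

module Pairs (N : ℕ) where

  open import Data.List.Membership.DecPropositional (Fin._≟_ {N}) using (_∈?_)

  Inside : List (Fin N) → Fin N × Fin N → Set
  Inside X (u , v) = u ∈ X × v ∈ X

  inside? : ∀ X → U.Decidable (Inside X)
  inside? X (u , v) = u ∈? X ×-dec v ∈? X

  open Greedy inside? public

  pairs : List (Fin N × Fin N)
  pairs = cartesianProduct (allFin N) (allFin N)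

  length-pairs : length pairs ≡ N * N
  length-pairs = trans (length-cartesianProduct (allFin N) (allFin N))
    (cong (λ l → l * l) (length-tabulate {n = N} id))

  count-pairs : ∀ X → count X pairs ≤ length X * length X
  count-pairs X = begin
    count X pairs                    ≤⟨ Unique∧⊆⇒length≤ (filter⁺ (inside? X) pairs!) ⊆X² ⟩
    length (cartesianProduct X X)    ≡⟨ length-cartesianProduct X X ⟩
    length X * length X              ∎
    where
    open ≤-Reasoning
    pairs! : Unique pairs
    pairs! = cartesianProduct⁺ (allFin⁺ N) (allFin⁺ N)
    ⊆X² : ∀ {p} → p ∈ filter (inside? X) pairs → p ∈ cartesianProduct X X
    ⊆X² p∈ with u∈X , v∈X ← proj₂ (∈-filter⁻ (inside? X) {xs = pairs} p∈) = ∈-cartesianProduct⁺ u∈X v∈X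

  -- With b = 4, a set holding f of the pairs has weight at least 5^f. By `dense` a random pair
  -- falls into a given set with probability at most 1/(4q), by `power` the potential grows by at
  -- most 3^f in M steps, and by `few` it then stays below 5^f.
  sparse-pairs : ∀ s q f M .{{_ : NonZero N}} .{{_ : NonZero q}} →
    q * (4 * (s * s)) ≤ N * N → length (sublists≤ (allFin N) s) * 3 ^ f < 5 ^ f →
    suc q ^ M ≤ 3 ^ f * q ^ M →
    ∃[ es ] length es ≡ M × (∀ X → length X ≤ s → count X es < f)
  sparse-pairs s q f M dense few power
    = let es , |es| , bound = sparse-sequence 4 q 𝓕 (zeroᵥ , zeroᵥ) pairs {{pairs≢0}} 𝓕-sparse M in
      es , |es| , λ X |X|≤s → ≤-<-trans
        (count-mono (Product.map (∈-filter⁺ (_∈? X) (∈-allFin _)) (∈-filter⁺ (_∈? X) (∈-allFin _))) es)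
        (sparse (bound (X∩allFin∈𝓕 X |X|≤s)))
    where
    open ≤-Reasoning
    𝓕 : List (List (Fin N))
    𝓕 = sublists≤ (allFin N) s
    zeroᵥ : Fin N
    zeroᵥ = Fin.fromℕ< (>-nonZero⁻¹ N)
    pairs≢0 : NonZero (length pairs)
    pairs≢0 = subst NonZero (sym length-pairs) (m*n≢0 N N)
    𝓕-sparse : ∀ {X} → X ∈ 𝓕 → q * (4 * count X pairs) ≤ length pairs
    𝓕-sparse {X} X∈ = begin
      q * (4 * count X pairs)         ≤⟨ *-monoʳ-≤ q (*-monoʳ-≤ 4 (count-pairs X)) ⟩
      q * (4 * (length X * length X)) ≤⟨ *-monoʳ-≤ q (*-monoʳ-≤ 4 (*-mono-≤ |X|≤s |X|≤s)) ⟩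
      q * (4 * (s * s))               ≤⟨ dense ⟩
      N * N                           ≡⟨ length-pairs ⟨
      length pairs                    ∎
      where
      |X|≤s : length X ≤ s
      |X|≤s = ∈sublists≤⇒length≤ (allFin N) s X∈
    sparse : ∀ {c} → q ^ M * 5 ^ c ≤ suc q ^ M * length 𝓕 → c < f
    sparse {c} bound = ≰⇒> λ f≤c → <⇒≱ few (*-cancelˡ-≤ (q ^ M) {{m^n≢0 q M}} (begin
      q ^ M * 5 ^ f               ≤⟨ *-monoʳ-≤ (q ^ M) (^-monoʳ-≤ 5 f≤c) ⟩
      q ^ M * 5 ^ c               ≤⟨ bound ⟩
      suc q ^ M * length 𝓕        ≤⟨ *-monoˡ-≤ (length 𝓕) power ⟩
      3 ^ f * q ^ M * length 𝓕    ≡⟨ xy∙z≈y∙zx (3 ^ f) (q ^ M) (length 𝓕) ⟩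
      q ^ M * (length 𝓕 * 3 ^ f)  ∎))
    -- `X` may list vertices in any order and repeatedly; its representative in `𝓕` has the same
    -- vertices in the order of `allFin N`.
    X∩allFin∈𝓕 : ∀ X → length X ≤ s → filter (_∈? X) (allFin N) ∈ 𝓕
    X∩allFin∈𝓕 X |X|≤s = filter∈sublists≤ (_∈? X) (allFin N) s (≤-trans
      (Unique∧⊆⇒length≤ (filter⁺ (_∈? X) (allFin⁺ N)) 
        (proj₂ ∘ ∈-filter⁻ (_∈? X) {xs = allFin N})) |X|≤s)

-- The `n`-th power of `[24r]^2*3^18L<5^18L`, as there are at most (24r)^(2n) sets.
few-sublists : ∀ r n L .{{_ : NonZero r}} .{{_ : NonZero n}} .{{_ : NonZero L}} → r < 2 ^ suc L →
  (xs : List A) → length xs ≡ 8 * r * (2 * n) →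
  length (sublists≤ xs (2 * n)) * 3 ^ (18 * L * n) < 5 ^ (18 * L * n)
few-sublists r n L r<2^ xs |xs| = ≤-<-trans
  (*-monoˡ-≤ (3 ^ (18 * L * n)) (length-sublists≤-bound r (2 * n) xs |xs|))
  (subst₂ _<_
    (trans (^-distribʳ-* n a b) (cong₂ _*_ (^-*-assoc (3 * (8 * r)) 2 n) (^-*-assoc 3 (18 * L) n)))
    (^-*-assoc 5 (18 * L) n)
    (^-monoˡ-< n ([24r]^2*3^18L<5^18L r L r<2^)))
  where
  a b : ℕ
  a = (3 * (8 * r)) ^ 2
  b = 3 ^ (18 * L)

-- Graphs given by lists of edges

edges : (G : Graph) → List (Fin (Graph.order G) × Fin (Graph.order G))
edges G = filter (λ (u , v) → (u Fin.<? v) ×-dec (u ~? v))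
                 (cartesianProduct (allFin order) (allFin order))
  where open Graph G

module _ (G : Graph) where
  open Graph G

  ∈-edges⁺ : ∀ {u v} → u Fin.< v → u ~ v → (u , v) ∈ edges G
  ∈-edges⁺ {u} {v} u<v u~v = ∈-filter⁺ (λ (u , v) → (u Fin.<? v) ×-dec (u ~? v))
    (∈-cartesianProduct⁺ (∈-allFin u) (∈-allFin v)) (u<v , u~v)

  ∈-edges⁻ : ∀ {u v} → (u , v) ∈ edges G → u Fin.< v × u ~ v
  ∈-edges⁻ = proj₂ ∘ ∈-filter⁻ (λ (u , v) → (u Fin.<? v) ×-dec (u ~? v))
    {xs = cartesianProduct (allFin order) (allFin order)}

  edges! : Unique (edges G)
  edges! = filter⁺ (λ (u , v) → (u Fin.<? v) ×-dec (u ~? v))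
    (cartesianProduct⁺ (allFin⁺ order) (allFin⁺ order))

  ~⇒∈-edges : ∀ {u v} → u ~ v → (u , v) ∈ edges G ⊎ (v , u) ∈ edges G
  ~⇒∈-edges {u} {v} u~v with Fin.<-cmp u v
  ... | tri< u<v _ _  = inj₁ (∈-edges⁺ u<v u~v)
  ... | tri≈ _ refl _ = contradiction u~v (~-irr refl)
  ... | tri> _ _ v<u  = inj₂ (∈-edges⁺ v<u (~-sym u~v))

-- The list may contain loops, repetitions and both orientations of a pair. Loops are discarded and
-- the rest merged, so `length es` only bounds the size from above.
edgeGraph : ∀ {N} → List (Fin N × Fin N) → Graph
edgeGraph {N} es = record
  { order = N
  ; _~_   = λ u v → u ≢ v × ((u , v) ∈ es ⊎ (v , u) ∈ es)
  ; _~?_  = λ u v → ¬? (u Fin.≟ v) ×-dec ((u , v) ∈? es ⊎-dec (v , u) ∈? es)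
  ; ~-sym = λ (u≢v , uv∈es) → u≢v ∘ sym , swap uv∈es
  ; ~-irr = λ u≡v (u≢v , _) → u≢v u≡v
  }
  where
  open import Data.List.Membership.DecPropositional
    (Product.≡-dec (Fin._≟_ {N}) (Fin._≟_ {N})) using (_∈?_)

size-edgeGraph≤ : ∀ {N} (es : List (Fin N × Fin N)) → size (edgeGraph es) ≤ length es
size-edgeGraph≤ {N} es = begin
  length (edges G)          ≤⟨ Unique∧⊆⇒length≤ (edges! G) ⊆es ⟩
  length (map orient es)    ≡⟨ length-map orient es ⟩
  length es                 ∎
  where
  open ≤-Reasoning
  G : Graph
  G = edgeGraph es
  orient : Fin N × Fin N → Fin N × Fin N
  -- `size` counts an edge with its smaller end first, so the entries of `es` are turned the same
  -- way before the comparison.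
  orient (u , v) = if does (u Fin.<? v) then (u , v) else (v , u)
  orient-< : ∀ {u v} → u Fin.< v → orient (u , v) ≡ (u , v)
  orient-< {u} {v} u<v rewrite dec-true (u Fin.<? v) u<v = refl
  orient-> : ∀ {u v} → u Fin.< v → orient (v , u) ≡ (u , v)
  orient-> {u} {v} u<v rewrite dec-false (v Fin.<? u) (<⇒≯ u<v) = refl
  ⊆es : ∀ {p} → p ∈ edges G → p ∈ map orient es
  ⊆es {u , v} p∈ with ∈-edges⁻ G p∈
  ... | u<v , _ , inj₁ uv∈es = subst (_∈ map orient es) (orient-< u<v) (∈-map⁺ orient uv∈es)
  ... | u<v , _ , inj₂ vu∈es = subst (_∈ map orient es) (orient-> u<v) (∈-map⁺ orient vu∈es)

-- Colour classes and their paths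

Linked-lookup : ∀ {R : Rel A 0ℓ} {xs} → Linked R xs → ∀ i j → toℕ j ≡ suc (toℕ i) →
                R (lookup xs i) (lookup xs j)
Linked-lookup (Rxy ∷ _)   zero    (suc zero) _  = Rxy
Linked-lookup (_ ∷ Rxs) (suc i) (suc j)  eq = Linked-lookup Rxs i j (suc-injective eq)

Unique-lookup-injective : ∀ {xs : List A} → Unique xs → Injective _≡_ _≡_ (lookup xs)
Unique-lookup-injective (_ ∷ _)     {zero}  {zero}  _  = refl
Unique-lookup-injective (x∉xs ∷ _)  {zero}  {suc j} eq = contradiction eq (All.lookup x∉xs (∈-lookup j))
Unique-lookup-injective (x∉xs ∷ _)  {suc i} {zero}  eq = contradiction (sym eq) (All.lookup x∉xs (∈-lookup i))
Unique-lookup-injective (_ ∷ xs!)   {suc i} {suc j} eq = cong suc (Unique-lookup-injective xs! eq)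

module Monochromatic {G : Graph} {r : ℕ} (χ : Colouring G r) where
  open Graph G
  open Colouring χ

  colour-unique : ∀ {u v} (e e′ : u ~ v) → colour e ≡ colour e′
  colour-unique e e′ = trans (colour-sym e (~-sym e)) (colour-sym (~-sym e) e′)

  _~[_]_ : Fin order → Fin r → Fin order → Set
  u ~[ c ] v = Σ[ e ∈ u ~ v ] colour e ≡ c

  ~[]-sym : ∀ c {u v} → u ~[ c ] v → v ~[ c ] u
  ~[]-sym c (e , ≡c) = ~-sym e , trans (colour-sym (~-sym e) e) ≡c

  ~[]-dec : ∀ c u v → Dec (u ~[ c ] v)
  ~[]-dec c u v with u ~? v
  ... | no ¬e = no (¬e ∘ proj₁)
  ... | yes e with colour e Fin.≟ c
  ...   | yes ≡c = yes (e , ≡c)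
  ...   | no ≢c  = no λ (e′ , ≡c) → ≢c (trans (colour-unique e e′) ≡c)

  path⇒copy : ∀ c {vs} → Linked (λ u v → u ~[ c ] v) vs → Unique vs →
              MonochromaticCopy (Path (length vs)) χ
  path⇒copy c {vs} linked vs! = c , lookup vs , Unique-lookup-injective vs! , adjacent
    where
    adjacent : ∀ {i j} → toℕ j ≡ suc (toℕ i) ⊎ toℕ i ≡ suc (toℕ j) → lookup vs i ~[ c ] lookup vs j
    adjacent {i} {j} (inj₁ eq) = Linked-lookup linked i j eq
    adjacent {i} {j} (inj₂ eq) = ~[]-sym c (Linked-lookup linked j i eq)

-- Sparse sequences force monochromatic paths

∃⊎∀ : ∀ {r} {P Q : Fin r → Set} → (∀ c → P c ⊎ Q c) → ∃ P ⊎ (∀ c → Q c)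
∃⊎∀ {zero}  P⊎Q = inj₂ λ ()
∃⊎∀ {suc r} P⊎Q with P⊎Q zero | ∃⊎∀ (P⊎Q ∘ suc)
... | inj₁ p | _            = inj₁ (zero , p)
... | inj₂ _ | inj₁ (c , p) = inj₁ (suc c , p)
... | inj₂ q | inj₂ qs      = inj₂ (Fin.∀-cons q qs)

length-concatMap≤ : ∀ {t} (f : A → List B) xs → (∀ x → length (f x) ≤ t) →
                    length (concatMap f xs) ≤ length xs * t
length-concatMap≤ f []       _  = z≤n
length-concatMap≤ f (x ∷ xs) ≤t = ≤-trans (≤-reflexive (length-++ (f x)))
  (+-mono-≤ (≤t x) (length-concatMap≤ f xs ≤t))

module _ {N : ℕ} (n r t g : ℕ) (es : List (Fin N × Fin N)) .{{_ : NonZero n}} .{{_ : NonZero r}} where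

  open Pairs N using (count; length≤bags*bound)

  -- The count runs over the entries of `es` rather than over edges, so repetitions and loops are
  -- included. If every colour has a cover, the r·t bags hold at most r·t·g entries, fewer than `es`
  -- has.
  sparse⇒Arrows : (∀ X → length X ≤ n + n → count X es ≤ g) → (∀ m → m * n < N + n → m ≤ t) →
                  r * t * g < length es → Arrows (edgeGraph es) (Path n) r
  sparse⇒Arrows sparse blocks many χ
    with ∃⊎∀ (λ c → DepthFirst.path-or-cover (λ u v → u ~[ c ] v) (~[]-dec c) (~[]-sym c) n
                      (allFin N) (>-nonZero⁻¹ n) (allFin⁺ N))
    where open Monochromatic χ
  ... | inj₁ (c , vs , path) = subst (λ l → MonochromaticCopy (Path l) χ) length≡ (path⇒copy c linked unique)
    where
    open Monochromatic χ
    open DepthFirst.IsPath path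
  ... | inj₂ covers = contradiction length-es≤ (<⇒≱ many)
    where
    open Monochromatic χ
    open Colouring χ
    open module Cover c = DepthFirst.EdgeCover (covers c)
    𝓑 : List (List (Fin N))
    𝓑 = concatMap bags (allFin r)
    length-bags≤ : ∀ c → length (bags c) ≤ t
    length-bags≤ c = blocks _ (subst (λ l → length (bags c) * n < l + n) (length-tabulate id) (few c))
    length-𝓑≤ : length 𝓑 ≤ r * t
    length-𝓑≤ = subst (λ l → length 𝓑 ≤ l * t) (length-tabulate {n = r} id)
      (length-concatMap≤ bags (allFin r) length-bags≤)
    𝓑-covers : ∀ {p} → p ∈ es → Any (λ X → proj₁ p ∈ X × proj₂ p ∈ X) 𝓑
    𝓑-covers {u , v} p∈es = by-colour edge-colour
      where
      edge-colour : ∃[ c ] (u ≡ v ⊎ u ~[ c ] v)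
      edge-colour with u Fin.≟ v
      -- A loop has no colour; the cover of colour 0 serves, as it puts every vertex into some bag.
      ... | yes u≡v = Fin.fromℕ< (>-nonZero⁻¹ r) , inj₁ u≡v
      ... | no u≢v  = _ , inj₂ ((u≢v , inj₁ p∈es) , refl)
      by-colour : ∃[ c ] (u ≡ v ⊎ u ~[ c ] v) → Any (λ X → u ∈ X × v ∈ X) 𝓑
      by-colour (c , u~v) = concatMap⁺ bags (lose (∈-allFin c) (Cover.covers c (∈-allFin u) (∈-allFin v) u~v))
    𝓑-light : ∀ {X} → X ∈ 𝓑 → count X es ≤ g
    𝓑-light X∈𝓑 with c , _ , X∈ ← find (concatMap⁻ bags {xs = allFin r} X∈𝓑) =
      sparse _ (All.lookup (small c) X∈)
    length-es≤ : length es ≤ r * t * g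
    length-es≤ = ≤-trans (length≤bags*bound es 𝓑 𝓑-covers 𝓑-light) (*-monoˡ-≤ g length-𝓑≤)

-- Existence of the size-Ramsey number

-- The minimum is found by search, which requires deciding `Arrows`. Embeddings and colourings are
-- therefore enumerated as vectors.
Searchable : Set → Set₁
Searchable A = ∀ {P : A → Set} → U.Decidable P → Dec (∃ P)

×-searchable : Searchable A → Searchable B → Searchable (A × B)
×-searchable A? B? P? = map′ (λ (a , b , p) → (a , b) , p) (λ ((a , b) , p) → a , b , p)
  (A? λ a → B? λ b → P? (a , b))

Vec-searchable : Searchable A → ∀ n → Searchable (Vec A n)
Vec-searchable A? zero    P? = map′ ([] ,_) (λ { ([] , p) → p }) (P? [])
Vec-searchable A? (suc n) P? = map′ (λ (a , v , p) → a ∷ v , p) (λ { (a ∷ v , p) → a , v , p })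
  (A? λ a → Vec-searchable A? n λ v → P? (a ∷ v))

searchable-∀ : Searchable A → ∀ {P : A → Set} → U.Decidable P → Dec (∀ a → P a)
searchable-∀ A? P? with A? (¬? ∘ P?)
... | yes (a , ¬p) = no λ ∀p → ¬p (∀p a)
... | no ¬∃¬p      = yes λ a → decidable-stable (P? a) λ ¬p → ¬∃¬p (a , ¬p)

module _ {G : Graph} {r : ℕ} (F : Graph) (χ : Colouring G r) where
  private
    module F = Graph F
    module G = Graph G
  open Monochromatic χ

  IsCopy : Fin r → (Fin F.order → Fin G.order) → Set
  IsCopy c φ = Injective _≡_ _≡_ φ × (∀ {u v} → u F.~ v → φ u ~[ c ] φ v)

  -- `lookup` of `tabulate φ` agrees with `φ` pointwise, and this carries a copy over to its table.
  IsCopy-resp-≗ : ∀ {c φ ψ} → φ ≗ ψ → IsCopy c φ → IsCopy c ψ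
  IsCopy-resp-≗ {c} φ≗ψ (inj , adj) =
    (λ {u} {v} eq → inj (trans (φ≗ψ u) (trans eq (sym (φ≗ψ v))))) ,
    (λ {u} {v} u~v → subst₂ (λ x y → x ~[ c ] y) (φ≗ψ u) (φ≗ψ v) (adj u~v))

  isCopy? : ∀ c φ → Dec (IsCopy c φ)
  isCopy? c φ =
    map′ (λ inj {u} {v} → inj u v) (λ inj u v → inj)
      (Fin.all? λ u → Fin.all? λ v → (φ u Fin.≟ φ v) →-dec (u Fin.≟ v)) ×-dec
    map′ (λ adj {u} {v} → adj u v) (λ adj u v → adj)
      (Fin.all? λ u → Fin.all? λ v → (u F.~? v) →-dec ~[]-dec c (φ u) (φ v))

  monochromaticCopy? : Dec (MonochromaticCopy F χ)
  monochromaticCopy? = Fin.any? λ c →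
    map′ (λ (v , copy) → Vec.lookup v , copy)
         (λ (φ , copy) → Vec.tabulate φ , IsCopy-resp-≗ (sym ∘ Vec.lookup∘tabulate φ) copy)
         (Vec-searchable Fin.any? F.order (isCopy? c ∘ Vec.lookup))

module _ {G : Graph} {r : ℕ} where
  open Graph G
  open Colouring

  MonochromaticCopy-resp : ∀ F (χ χ′ : Colouring G r) →
                           (∀ {u v} (e : u ~ v) → colour χ e ≡ colour χ′ e) →
                           MonochromaticCopy F χ → MonochromaticCopy F χ′
  MonochromaticCopy-resp F χ χ′ χ≡χ′ (c , φ , inj , adj) =
    c , φ , inj , λ u~v → proj₁ (adj u~v) , trans (sym (χ≡χ′ (proj₁ (adj u~v)))) (proj₂ (adj u~v))

  -- Reading only the entries with the smaller vertex first makes a symmetric colouring out of any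
  -- table `κ`.
  colourBy : (Fin order → Fin order → Fin r) → Colouring G r
  colourBy κ = record
    { colour     = λ {u} {v} _ → if does (u Fin.<? v) then κ u v else κ v u
    ; colour-sym = λ {u} {v} e _ → symmetric u v e }
    where
    symmetric : ∀ u v → u ~ v → (if does (u Fin.<? v) then κ u v else κ v u) ≡
                                (if does (v Fin.<? u) then κ v u else κ u v)
    symmetric u v e with Fin.<-cmp u v
    ... | tri< u<v _ v≮u rewrite dec-true (u Fin.<? v) u<v | dec-false (v Fin.<? u) v≮u = refl
    ... | tri≈ _ refl _ = contradiction e (~-irr refl)
    ... | tri> u≮v _ v<u rewrite dec-false (u Fin.<? v) u≮v | dec-true (v Fin.<? u) v<u = refl

-- Every colouring agrees on all edges with one read off a finite table, and having a monochromatic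
-- copy depends only on these values.
arrows? : ∀ G F r .{{_ : NonZero r}} → Dec (Arrows G F r)
arrows? G F r@(suc _) =
  map′ (λ all χ → MonochromaticCopy-resp {G} {r} F (colourBy {G} (table (tableOf χ))) χ
         (colourBy-tableOf χ) (all (tableOf χ)))
       (λ arrows t → arrows (colourBy {G} (table t)))
       (searchable-∀ (Vec-searchable (Vec-searchable Fin.any? order) order)
          (λ t → monochromaticCopy? F (colourBy {G} (table t))))
  where
  open Graph G
  open Colouring
  Table : Set
  Table = Vec (Vec (Fin r) order) order
  table : Table → Fin order → Fin order → Fin r
  table t u v = Vec.lookup (Vec.lookup t u) v
  colour⁺ : Colouring G r → Fin order → Fin order → Fin r
  colour⁺ χ u v with u ~? v
  ... | yes e = colour χ e
  -- A default for non-adjacent pairs, whose entries no edge reads.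
  ... | no _  = zero
  tableOf : Colouring G r → Table
  tableOf χ = Vec.tabulate λ u → Vec.tabulate (colour⁺ χ u)
  table-tableOf : ∀ χ {u v} (e : u ~ v) → table (tableOf χ) u v ≡ colour χ e
  table-tableOf χ {u} {v} e = begin
    Vec.lookup (Vec.lookup (tableOf χ) u) v       ≡⟨ cong (λ w → Vec.lookup w v) (Vec.lookup∘tabulate _ u) ⟩
    Vec.lookup (Vec.tabulate (colour⁺ χ u)) v     ≡⟨ Vec.lookup∘tabulate _ v ⟩
    colour⁺ χ u v                                 ≡⟨ colour⁺≡ ⟩
    colour χ e                                    ∎
    where
    open ≡-Reasoning
    colour⁺≡ : colour⁺ χ u v ≡ colour χ e
    colour⁺≡ with u ~? v
    ... | yes e′ = Monochromatic.colour-unique χ e′ e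
    ... | no ¬e  = contradiction e ¬e
  colourBy-tableOf : ∀ χ {u v} (e : u ~ v) → colour (colourBy {G} (table (tableOf χ))) e ≡ colour χ e
  colourBy-tableOf χ {u} {v} e with does (u Fin.<? v)
  ... | true  = table-tableOf χ e
  ... | false = trans (table-tableOf χ (~-sym e)) (colour-sym χ (~-sym e) e)

-- A vertex of `vs` is labelled by its index there, shifted by one; all other vertices share the
-- label `zero`.
position : ∀ {N} (vs : List (Fin N)) →
  ∃[ pos ] (∀ {u v} → u ∈ vs → pos u ≡ pos v → u ≡ v)
position {N} vs = pos , inj
  where
  open import Data.List.Membership.DecPropositional (Fin._≟_ {N}) using (_∈?_)
  pos : Fin N → Fin (suc (length vs))
  pos u with u ∈? vs
  ... | yes u∈vs = suc (index u∈vs)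
  ... | no _     = zero
  inj : ∀ {u v} → u ∈ vs → pos u ≡ pos v → u ≡ v
  inj {u} {v} u∈vs eq with u ∈? vs | v ∈? vs
  ... | no u∉vs | _ = contradiction u∈vs u∉vs
  ... | yes p | yes q = trans (lookup-index p)
    (trans (cong (lookup vs) (Fin.suc-injective eq)) (sym (lookup-index q)))

endpoints : List (A × A) → List A
endpoints es = map proj₁ es ++ map proj₂ es

length-endpoints : (es : List (A × A)) → length (endpoints es) ≡ length es + length es
length-endpoints es = trans (length-++ (map proj₁ es))
  (cong₂ _+_ (length-map proj₁ es) (length-map proj₂ es))

-- A graph has at most twice as many non-isolated vertices as edges, and each vertex of a copy of
-- `F` lies on an edge. Merging all isolated vertices into one thus keeps every copy and leaves
-- finitely many candidates for each number of edges.
relabel : ∀ G F r → (∀ u → ∃[ v ] Graph._~_ F u v) → Arrows G F r →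
  ∃[ es ] length es ≡ size G × Arrows (edgeGraph {suc (size G + size G)} es) F r
relabel G F r F-connects arrows =
  subst (λ l → ∃[ es ] length es ≡ size G × Arrows (edgeGraph {suc l} es) F r)
    (length-endpoints (edges G))
    (es′ , length-map pos² (edges G) , arrows′)
  where
  open Graph G
  pos : Fin order → Fin (suc (length (endpoints (edges G))))
  pos = proj₁ (position (endpoints (edges G)))
  pos-injective : ∀ {u v} → u ∈ endpoints (edges G) → pos u ≡ pos v → u ≡ v
  pos-injective = proj₂ (position (endpoints (edges G)))
  pos² : Fin order × Fin order → _
  pos² = Product.map pos pos
  es′ : List _
  es′ = map pos² (edges G)
  ~⇒∈-endpoints : ∀ {u v} → u ~ v → u ∈ endpoints (edges G)
  ~⇒∈-endpoints u~v with ~⇒∈-edges G u~v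
  ... | inj₁ uv∈ = ∈-++⁺ˡ (∈-map⁺ proj₁ uv∈)
  ... | inj₂ vu∈ = ∈-++⁺ʳ (map proj₁ (edges G)) (∈-map⁺ proj₂ vu∈)
  relabel-~ : ∀ {u v} → u ~ v → Graph._~_ (edgeGraph es′) (pos u) (pos v)
  relabel-~ u~v =
    (λ eq → ~-irr (pos-injective (~⇒∈-endpoints u~v) eq) u~v) ,
    membership (~⇒∈-edges G u~v)
    where
    membership : ∀ {u v} → (u , v) ∈ edges G ⊎ (v , u) ∈ edges G →
                 (pos u , pos v) ∈ es′ ⊎ (pos v , pos u) ∈ es′
    membership (inj₁ uv∈) = inj₁ (∈-map⁺ pos² uv∈)
    membership (inj₂ vu∈) = inj₂ (∈-map⁺ pos² vu∈)
  arrows′ : Arrows (edgeGraph es′) F r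
  arrows′ χ′ with arrows χ
    where
    open Colouring χ′
    χ : Colouring G r
    χ = record
      { colour = λ e → colour (relabel-~ e)
      ; colour-sym = λ e e′ → colour-sym (relabel-~ e) (relabel-~ e′) }
  ... | c , φ , inj , adj = c , pos ∘ φ ,
    -- The image of `x` is an end of an edge, and on such vertices `pos` is injective.
    (λ {x} eq → inj (pos-injective (~⇒∈-endpoints (proj₁ (adj (proj₂ (F-connects x))))) eq)) ,
    (λ u~v → relabel-~ (proj₁ (adj u~v)) , proj₂ (adj u~v))

least : ∀ {P : ℕ → Set} → U.Decidable P → ∀ {k} → P k → ∃[ m ] P m × (∀ {j} → P j → m ≤ j)
least {P} P? {k} Pk with below (suc k)
  where
  below : ∀ k → (∃[ m ] P m × (∀ {j} → P j → m ≤ j)) ⊎ (∀ {j} → j < k → ¬ P j)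
  below zero = inj₂ λ ()
  below (suc k) with below k
  ... | inj₁ found = inj₁ found
  ... | inj₂ none with P? k
  ...   | yes Pk = inj₁ (k , Pk , λ Pj → ≮⇒≥ λ j<k → none j<k Pj)
  ...   | no ¬Pk = inj₂ λ j<1+k → case m≤n⇒m<n∨m≡n (s≤s⁻¹ j<1+k) of λ where
      (inj₁ j<k)  → none j<k
      (inj₂ refl) → ¬Pk
... | inj₁ found = found
... | inj₂ none  = contradiction Pk (none ≤-refl)

module _ (F : Graph) (r : ℕ) .{{_ : NonZero r}} (F-connects : ∀ u → ∃[ v ] Graph._~_ F u v) where

  private
    -- By `relabel`, sequences of k pairs on 2k + 1 vertices represent all arrowing graphs of size
    -- k, so each k needs only a finite search.
    Realises : ℕ → Set
    Realises k = ∃[ es ] Arrows (edgeGraph {suc (k + k)} (Vec.toList {n = k} es)) F r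

    realises? : U.Decidable Realises
    realises? k = Vec-searchable (×-searchable Fin.any? Fin.any?) k
      λ es → arrows? (edgeGraph (Vec.toList es)) F r

    realises-size : ∀ G → Arrows G F r → Realises (size G)
    realises-size G arrows with es , |es| , arrows′ ← relabel G F r F-connects arrows =
      subst (λ k → ∃[ es ] Arrows (edgeGraph {suc (size G + size G)} (Vec.toList {n = k} es)) F r) |es|
        (Vec.fromList es , subst (λ es → Arrows (edgeGraph es) F r) (sym (Vec.toList∘fromList es)) arrows′)

  sizeRamsey-exists : ∀ G → Arrows G F r → ∃[ m ] IsSizeRamsey F r m × m ≤ size G
  sizeRamsey-exists G arrows
    with m , (es , realised) , minimal ← least realises? (realises-size G arrows) =
    m , record
      -- The pairs might collapse to fewer than `m` edges, but then a smaller number would be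
      -- realised.
      { attained = H , realised , ≤-antisym |H|≤m (minimal (realises-size H realised))
      ; minimal  = λ G′ → minimal ∘ realises-size G′ }
    , minimal (realises-size G arrows)
    where
    H : Graph
    H = edgeGraph (Vec.toList es)
    |H|≤m : size H ≤ m
    |H|≤m = subst (size H ≤_) (Vec.length-toList es) (size-edgeGraph≤ (Vec.toList es))

-- The order starts at two because the only vertex of `Path 1` is isolated.
Path-connects : ∀ n (u : Fin (suc (suc n))) → ∃[ v ] Graph._~_ (Path (suc (suc n))) u v
Path-connects n zero    = suc zero , inj₁ refl
Path-connects n (suc u) = inject₁ u , inj₂ (cong suc (sym (Fin.toℕ-inject₁ u)))

-- A lower bound for the logarithm

sum-cong : ∀ {f g : ℕ → ℚᵘ} → f ≗ g → sum f ≗ sum g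
sum-cong f≗g zero    = refl
sum-cong f≗g (suc n) = cong₂ ℚ._+_ (sum-cong f≗g n) (f≗g n)

sum-+ : ∀ f m n → sum f (m + n) ℚ.≃ sum f m ℚ.+ sum (f ∘ (m +_)) n
sum-+ f m zero rewrite +-identityʳ m = ℚ.≃-sym (ℚ.+-identityʳ (sum f m))
sum-+ f m (suc n) rewrite +-suc m n = ℚ.≃-trans
  (ℚ.+-congˡ (f (m + n)) (sum-+ f m n))
  (ℚ.+-assoc (sum f m) (sum (f ∘ (m +_)) n) (f (m + n)))

n*c≤sum : ∀ {f} c n → (∀ i → i < n → c ℚ.≤ f i) → (int n ℚ./ 1) ℚ.* c ℚ.≤ sum f n
n*c≤sum c zero    _   = ℚ.≤-reflexive (ℚ.*-zeroˡ c)
n*c≤sum {f} c (suc n) c≤f = begin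
  (int (suc n) ℚ./ 1) ℚ.* c          ≃⟨ ℚ.*-congʳ {c} suc≃ ⟩
  ((int n ℚ./ 1) ℚ.+ 1ℚᵘ) ℚ.* c    ≃⟨ ℚ.*-distribʳ-+ c (int n ℚ./ 1) 1ℚᵘ ⟩
  (int n ℚ./ 1) ℚ.* c ℚ.+ 1ℚᵘ ℚ.* c ≃⟨ ℚ.+-congʳ ((int n ℚ./ 1) ℚ.* c) (ℚ.*-identityˡ c) ⟩
  (int n ℚ./ 1) ℚ.* c ℚ.+ c        ≤⟨ ℚ.+-mono-≤ (n*c≤sum c n (λ i → c≤f i ∘ m<n⇒m<1+n)) (c≤f n ≤-refl) ⟩
  sum f n ℚ.+ f n                ∎
  where
  open ℚ.≤-Reasoning
  suc≃ : int (suc n) ℚ./ 1 ℚ.≃ (int n ℚ./ 1) ℚ.+ 1ℚᵘ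
  suc≃ = *≡* (lemma (int n))
    where
    lemma : ∀ x → (int 1 ℤ.+ x) ℤ.* int 1 ≡ (x ℤ.* int 1 ℤ.+ int 1 ℤ.* int 1) ℤ.* int 1
    lemma = ℤ-Solver.solve-∀

module _ {f : ℕ → ℚᵘ} (0≤f : ∀ i → 0ℚᵘ ℚ.≤ f i) where

  sum-monoʳ : ∀ {m n} → m ≤ n → sum f m ℚ.≤ sum f n
  sum-monoʳ {m} {n} m≤n with k , refl ← m≤n⇒∃[o]m+o≡n m≤n = begin
    sum f m                                ≃⟨ ℚ.+-identityʳ (sum f m) ⟨
    sum f m ℚ.+ 0ℚᵘ                        ≤⟨ ℚ.+-monoʳ-≤ (sum f m) 0≤rest ⟩
    sum f m ℚ.+ sum (f ∘ (m +_)) k       ≃⟨ sum-+ f m k ⟨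
    sum f (m + k)                        ∎
    where
    open ℚ.≤-Reasoning
    0≤rest : 0ℚᵘ ℚ.≤ sum (f ∘ (m +_)) k
    0≤rest = ℚ.≤-trans (ℚ.≤-reflexive (ℚ.≃-sym (ℚ.*-zeroʳ (int k ℚ./ 1))))
                       (n*c≤sum 0ℚᵘ k (λ i _ → 0≤f (m + i)))

-- These are the summands of `logSum`.
harmonic : ℕ → ℕ → ℚᵘ
harmonic a i = int 1 ℚ./ suc (a + i)

-- Oresme's argument: each of the `a` terms 1/(a + 1), ..., 1/(2a) is at least 1/(2a).
½≤harmonic-sum : ∀ a .{{_ : NonZero a}} → ½ ℚ.≤ sum (harmonic a) a
½≤harmonic-sum a@(suc _) = ℚ.≤-trans
  (ℚ.≤-reflexive (*≡* {q = (int a ℚ./ 1) ℚ.* c} eq)) (n*c≤sum c a each)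
  where
  c : ℚᵘ
  c = int 1 ℚ./ (a + a)
  eq : int 1 ℤ.* int (1 * (a + a)) ≡ int a ℤ.* int 1 ℤ.* int 2
  eq = trans (cong (λ x → int 1 ℤ.* int x) (*-identityˡ (a + a)))
    (trans (cong (int 1 ℤ.*_) (ℤ.pos-+ a a)) (lemma (int a)))
    where
    lemma : ∀ x → int 1 ℤ.* (x ℤ.+ x) ≡ x ℤ.* int 1 ℤ.* int 2
    lemma = ℤ-Solver.solve-∀
  each : ∀ i → i < a → c ℚ.≤ harmonic a i
  each i i<a = *≤* (+≤+ (+-monoˡ-≤ 0 (+-monoʳ-< a i<a)))

-- The sum 1/(K + 1) + ... + 1/(2^L K) splits into `L` blocks, one from 1/(a + 1) to 1/(2a) for each
-- a = 2^i K with i < L, and each block contributes at least 1/2.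
L/2≤harmonic-sum : ∀ L K d .{{_ : NonZero K}} → K + d ≡ 2 ^ L * K → int L ℚ./ 2 ℚ.≤ sum (harmonic K) d
L/2≤harmonic-sum zero K d eq
  rewrite +-cancelˡ-≡ K d 0 (trans eq (trans (*-identityˡ K) (sym (+-identityʳ K)))) =
  *≤* (+≤+ z≤n)
L/2≤harmonic-sum (suc L) K d′ eq = begin
  int (suc L) ℚ./ 2                                     ≃⟨ *≡* {q = int L ℚ./ 2 ℚ.+ ½} (lemma (int L)) ⟩
  int L ℚ./ 2 ℚ.+ ½                                   ≤⟨ ℚ.+-mono-≤ (L/2≤harmonic-sum L K d K+d≡a) (½≤harmonic-sum a) ⟩
  sum (harmonic K) d ℚ.+ sum (harmonic a) a         ≡⟨ cong (sum (harmonic K) d ℚ.+_) (sum-cong shifted a) ⟩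
  sum (harmonic K) d ℚ.+ sum (harmonic K ∘ (d +_)) a ≃⟨ sum-+ (harmonic K) d a ⟨
  sum (harmonic K) (d + a)                        ≡⟨ cong (sum (harmonic K)) d′≡d+a ⟨
  sum (harmonic K) d′                               ∎
  where
  open ℚ.≤-Reasoning
  a d : ℕ
  a = 2 ^ L * K
  d = a ∸ K
  instance
    a≢0 : NonZero a
    a≢0 = m*n≢0 (2 ^ L) K {{m^n≢0 2 L}}
  K+d≡a : K + d ≡ a
  K+d≡a = m+[n∸m]≡n (m≤n*m K (2 ^ L) {{m^n≢0 2 L}})
  shifted : harmonic a ≗ harmonic K ∘ (d +_)
  shifted i = cong (λ x → int 1 ℚ./ suc x) (trans (cong (_+ i) (sym K+d≡a)) (+-assoc K d i))
  d′≡d+a : d′ ≡ d + a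
  d′≡d+a = +-cancelˡ-≡ K d′ (d + a) (trans eq (trans (double (2 ^ L) K)
    (trans (cong (_+ a) (sym K+d≡a)) (+-assoc K d a))))
    where
    double : ∀ x y → 2 * x * y ≡ x * y + x * y
    double = solve-∀
  lemma : ∀ x → (int 1 ℤ.+ x) ℤ.* int 4 ≡ (x ℤ.* int 2 ℤ.+ int 1 ℤ.* int 2) ℤ.* int 2
  lemma = ℤ-Solver.solve-∀

-- The sum down to 1/(2^L K) is an initial part of `logSum r K`, whose other terms are nonnegative.
L/2≤logSum : ∀ L r K .{{_ : NonZero K}} → 2 ^ L ≤ r → int L ℚ./ 2 ℚ.≤ logSum r K
L/2≤logSum L r K 2^L≤r = ℚ.≤-trans
  (L/2≤harmonic-sum L K ((2 ^ L ∸ 1) * K) eq)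
  (sum-monoʳ (λ i → ℚ.nonNegative⁻¹ (harmonic K i)) (*-monoˡ-≤ K (∸-monoˡ-≤ 1 2^L≤r)))
  where
  eq : K + (2 ^ L ∸ 1) * K ≡ 2 ^ L * K
  eq = cong (_* K) (m+[n∸m]≡n (m^n>0 2 L))

below-log-bound : ∀ L r n m → 2 ^ L ≤ r → m < 300 * L * (r * r) * n →
  fromℕ m <ℝ fromℕ 600 *ℝ log r *ℝ (fromℕ r *ℝ fromℕ r) *ℝ fromℕ n
-- As m + 1 ≤ 300Lr²n and every approximation of `log r` is at least L/2, the gap 1 works from index
-- 0 on.
below-log-bound L r n m 2^L≤r m< = 1ℚᵘ , ℚ.positive⁻¹ 1ℚᵘ , 0 , λ k _ → bound (suc k)
  where
  open ℚ.≤-Reasoning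
  bound : ∀ K .{{_ : NonZero K}} → int m ℚ./ 1 ℚ.+ 1ℚᵘ ℚ.≤
          (int 600 ℚ./ 1) ℚ.* logSum r K ℚ.* ((int r ℚ./ 1) ℚ.* (int r ℚ./ 1)) ℚ.* (int n ℚ./ 1)
  bound K = begin
    int m ℚ./ 1 ℚ.+ 1ℚᵘ
      ≃⟨ *≡* {q = int (suc m) ℚ./ 1} (lemma (int m)) ⟩
    int (suc m) ℚ./ 1
      ≤⟨ *≤* (ℤ.*-monoʳ-≤-nonNeg (int 1) (+≤+ m<)) ⟩
    int (300 * L * (r * r) * n) ℚ./ 1
      ≃⟨ *≡* {q = (int 600 ℚ./ 1) ℚ.* (int L ℚ./ 2) ℚ.* (r/1 ℚ.* r/1) ℚ.* n/1} scale ⟩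
    (int 600 ℚ./ 1) ℚ.* (int L ℚ./ 2) ℚ.* (r/1 ℚ.* r/1) ℚ.* n/1
      ≤⟨ ℚ.*-monoˡ-≤-nonNeg n/1 (ℚ.*-monoˡ-≤-nonNeg (r/1 ℚ.* r/1) {{ℚ.nonNeg*nonNeg⇒nonNeg r/1 r/1}}
           (ℚ.*-monoʳ-≤-nonNeg (int 600 ℚ./ 1) (L/2≤logSum L r K 2^L≤r))) ⟩
    (int 600 ℚ./ 1) ℚ.* logSum r K ℚ.* (r/1 ℚ.* r/1) ℚ.* n/1 ∎
    where
    r/1 n/1 : ℚᵘ
    r/1 = int r ℚ./ 1
    n/1 = int n ℚ./ 1
    lemma : ∀ x → (x ℤ.* int 1 ℤ.+ int 1 ℤ.* int 1) ℤ.* int 1 ≡ (int 1 ℤ.+ x) ℤ.* int 1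
    lemma = ℤ-Solver.solve-∀
    scale : int (300 * L * (r * r) * n) ℤ.* int 2 ≡ int 600 ℤ.* int L ℤ.* (int r ℤ.* int r) ℤ.* int n ℤ.* int 1
    scale = trans (cong (ℤ._* int 2) pos) (ring (int L) (int r) (int n))
      where
      pos : int (300 * L * (r * r) * n) ≡ int 300 ℤ.* int L ℤ.* (int r ℤ.* int r) ℤ.* int n
      pos = trans (ℤ.pos-* (300 * L * (r * r)) n) (cong (ℤ._* int n)
        (trans (ℤ.pos-* (300 * L) (r * r)) (cong₂ ℤ._*_ (ℤ.pos-* 300 L) (ℤ.pos-* r r))))
      ring : ∀ x y z → int 300 ℤ.* x ℤ.* (y ℤ.* y) ℤ.* z ℤ.* int 2 ≡ int 600 ℤ.* x ℤ.* (y ℤ.* y) ℤ.* z ℤ.* int 1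
      ring = ℤ-Solver.solve-∀

-- The host graph

bracket-by-powers-of-2 : ∀ r .{{_ : NonZero r}} → ∃[ L ] 2 ^ L ≤ r × r < 2 ^ suc L
bracket-by-powers-of-2 1 = 0 , ≤-refl , ≤-refl
bracket-by-powers-of-2 (suc r@(suc _))
  with L , lower , upper ← bracket-by-powers-of-2 r with m≤n⇒m<n∨m≡n upper
... | inj₁ 1+r<2^ = L , m≤n⇒m≤1+n lower , 1+r<2^
... | inj₂ 1+r≡2^ = suc L , ≤-reflexive (sym 1+r≡2^) ,
  subst (_< 2 ^ suc (suc L)) (sym 1+r≡2^) (^-monoʳ-< 2 ≤-refl {suc L} ≤-refl)

small-Ramsey-graph : ∀ r n L .{{_ : NonZero r}} .{{_ : NonZero n}} .{{_ : NonZero L}} → r < 2 ^ suc L →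
  ∃[ G ] Arrows G (Path n) r × size G ≤ 288 * L * (r * r) * n
small-Ramsey-graph r n L r<2^ =
  let es , |es| , sparse = Pairs.sparse-pairs N (2 * n) q f (q * f)
        (≤-reflexive (dense r n)) (few-sublists r n L r<2^ (allFin N) (length-tabulate id))
        ([1+k]^[kx]≤3^x*k^[kx] (2 * (r * r)) f)
  in edgeGraph es
   , sparse⇒Arrows n r (16 * r) (pred f) es
       (λ X |X|≤ → <⇒≤pred (sparse X (subst (length X ≤_) (cong (n +_) (sym (+-identityʳ n))) |X|≤)))
       blocks (subst₂ _<_ (cong (_* pred f) (q≡ r)) (sym |es|) (*-monoʳ-< q pred[f]<f))
   , ≤-trans (size-edgeGraph≤ es) (≤-reflexive (trans |es| (q*f≡ r L n)))
  where
  -- The shapes fit the estimates above: N = 16rn is 8r times the set size 2n, and q = 16r² is 8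
  -- times 2r². Moreover q = N²/(4(2n)²), the largest value that the density condition allows, and q
  -- = r·16r bounds the total number of bags.
  N q f : ℕ
  N = 8 * r * (2 * n)
  q = 8 * (2 * (r * r))
  f = 18 * L * n
  instance
    N≢0 : NonZero N
    N≢0 = m*n≢0 (8 * r) (2 * n) {{m*n≢0 8 r}} {{m*n≢0 2 n}}
    q≢0 : NonZero q
    q≢0 = m*n≢0 8 (2 * (r * r)) {{_}} {{m*n≢0 2 (r * r) {{_}} {{m*n≢0 r r}}}}
    f≢0 : NonZero f
    f≢0 = m*n≢0 (18 * L) n {{m*n≢0 18 L}}
  dense : ∀ r n → 8 * (2 * (r * r)) * (4 * (2 * n * (2 * n))) ≡ 8 * r * (2 * n) * (8 * r * (2 * n))
  dense = solve-∀
  q≡ : ∀ r → 8 * (2 * (r * r)) ≡ r * (16 * r)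
  q≡ = solve-∀
  q*f≡ : ∀ r L n → 8 * (2 * (r * r)) * (18 * L * n) ≡ 288 * L * (r * r) * n
  q*f≡ = solve-∀
  pred[f]<f : pred f < f
  pred[f]<f = subst (pred f <_) (suc-pred f) ≤-refl
  blocks : ∀ m → m * n < N + n → m ≤ 16 * r
  blocks m m*n< = s≤s⁻¹ (*-cancelʳ-< n m (suc (16 * r)) (subst (m * n <_) (lemma r n) m*n<))
    where
    lemma : ∀ r n → 8 * r * (2 * n) + n ≡ suc (16 * r) * n
    lemma = solve-∀

theorem1p2 : ∀ (r : ℕ) → r ≥ 2 →
    ∃[ N ] ∀ (n : ℕ) → n ≥ N →
    ∃[ m ] IsSizeRamsey (Path n) r m ×
    fromℕ m <ℝ fromℕ 600 *ℝ log r *ℝ (fromℕ r *ℝ fromℕ r) *ℝ fromℕ n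
theorem1p2 r@(suc _) r≥2 with bracket-by-powers-of-2 r
... | zero , _ , r<2 = contradiction r≥2 (<⇒≱ r<2)
-- The threshold 2 is the order from which `Path-connects` applies.
... | L@(suc _) , 2^L≤r , r<2^ = 2 , λ where
  (suc zero) (s≤s ())
  n@(suc (suc n′)) _ →
    let G , arrows , size≤ = small-Ramsey-graph r n L r<2^
        m , isSizeRamsey , m≤size = sizeRamsey-exists (Path n) r (Path-connects n′) G arrows
    in m , isSizeRamsey , below-log-bound L r n m 2^L≤r (≤-<-trans (≤-trans m≤size size≤)
         -- The slack between 288 and 300 makes the inequality strict.
         (*-monoˡ-< n (*-monoˡ-< (r * r) (*-monoˡ-< L (≤ᵇ⇒≤ 289 300 tt)))))
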